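{- For $n\ge1$, \begin{align*} D_{n}(p,q,t)&=\sum_{k=0}^{\lfloor (n-1)/2\rfloor} \mathrm{d}_{n,k}(p,q)\,t^k =\sum_{\sigma\in \mathfrak{D}_{n}}p^{\operatorname{res}\sigma}q^{\operatorname{les}\sigma-\operatorname{des}\sigma}t^{\operatorname{des}\sigma}. \end{align*}
   Context: Let $[n]_{p,q}=\sum_{i+j=n-1}p^iq^j$ and $\binom{n}{k}_{p,q}=\frac{[n]_{p,q}\cdots[n-k+1]_{p,q}}{[1]_{p,q}\cdots[k]_{p,q}}$. The polynomials $D_n(p,q,t)$ are defined by the continued fraction $\sum_{n\ge0}D_{n+1}(p,q,t)x^n=\cfrac{1}{1-[1]_{p,q}x-\cfrac{\binom{2}{2}_{p,q}t\,x^2}{1-[2]_{p,q}x-\cfrac{\binom{3}{2}_{p,q}t\,x^2}{1-[3]_{p,q}x-\cdots}}}$ (J-fraction with $b_m=[m+1]_{p,q}$, $\lambda_m=\binom{m+1}{2}_{p,q}t$). For a permutation $\sigma=\sigma_1\ldots\sigma_n$ of $[n]$: $\operatorname{des}\sigma$ is the number of $i<n$ with $\sigma_i>\sigma_{i+1}$; $\operatorname{les}\sigma$ is the number of pairs $(i,j)$ with $2\le i<j\le n$ and $\sigma_{i-1}>\sigma_j>\sigma_i$; $\operatorname{res}\sigma$ is the number of pairs $(i,j)$ with $1\le i<j\le n-1$ and $\sigma_{j+1}>\sigma_i>\sigma_j$. With $\sigma_0=\sigma_{n+1}=0$, $\sigma_i$ is a double descent if $\sigma_{i-1}>\sigma_i>\sigma_{i+1}$.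 $\sigma_{[k]}$ is the subword of $\sigma$ formed by $1,\dots,k$; $\sigma$ is an André permutation if for every $1\le k\le n$, $\sigma_{[k]}$ has no double descents and ends with an ascent. $\mathfrak{D}_n$ is the set of André permutations of $[n]$, $\mathfrak{D}_{n,k}$ those with $k$ descents, and $\mathrm{d}_{n,k}(p,q)=\sum_{\sigma\in\mathfrak{D}_{n,k}}p^{\operatorname{res}\sigma}q^{\operatorname{les}\sigma-k}$. -}

module Defs where

open import Level using (Level)
open import Algebra.Bundles using (CommutativeSemiring)
open import Data.Nat.Base as ℕ using (ℕ; zero; suc; _∸_; _≡ᵇ_; _<ᵇ_; ⌊_/2⌋)
open import Data.Bool.Base using (Bool; true; false; _∧_; _∨_; not; if_then_else_)
open import Data.List.Base using (List; []; _∷_; _++_; map; concatMap; filter; foldr; upTo; [_])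
open import Relation.Binary.PropositionalEquality using (_≡_)
open import Relation.Nullary.Decidable using (Dec; yes; no)
open import Data.Bool.Properties using (_≟_)

range : ℕ → List ℕ
range n = map suc (upTo n)

words : ℕ → ℕ → List (List ℕ)
words zero    n = [] ∷ []
words (suc k) n = concatMap (λ w → map (λ a → a ∷ w) (range n)) (words k n)

elem : ℕ → List ℕ → Bool
elem a []       = false
elem a (b ∷ bs) = (a ≡ᵇ b) ∨ elem a bs

allB : {A : Set} → (A → Bool) → List A → Bool
allB P []       = true
allB P (x ∷ xs) = P x ∧ allB P xs

-- a word of length n is a permutation of [n] iff it contains each of 1..n
isPerm : ℕ → List ℕ → Bool
isPerm n w = allB (λ i → elem i w) (range n)

perms : ℕ → List (List ℕ)
perms n = filter (λ w → isPerm n w ≟ true) (words n n)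

b2n : Bool → ℕ
b2n true  = 1
b2n false = 0

des : List ℕ → ℕ
des (a ∷ b ∷ r) = b2n (b <ᵇ a) ℕ.+ des (b ∷ r)
des _           = 0

countBetween : ℕ → ℕ → List ℕ → ℕ
countBetween lo hi []      = 0
countBetween lo hi (c ∷ r) = b2n ((lo <ᵇ c) ∧ (c <ᵇ hi)) ℕ.+ countBetween lo hi r

les : List ℕ → ℕ
les (a ∷ b ∷ r) = countBetween b a r ℕ.+ les (b ∷ r)
les _           = 0

countAdj : ℕ → List ℕ → ℕ
countAdj x (c ∷ d ∷ r) = b2n ((c <ᵇ x) ∧ (x <ᵇ d)) ℕ.+ countAdj x (d ∷ r)
countAdj x _           = 0

res : List ℕ → ℕ
res []      = 0
res (x ∷ r) = countAdj x r ℕ.+ res r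

-- double descents of a word padded with zeros: σ_0 = σ_{n+1} = 0
hasDDpadded : List ℕ → Bool
hasDDpadded (a ∷ b ∷ c ∷ r) = ((b <ᵇ a) ∧ (c <ᵇ b)) ∨ hasDDpadded (b ∷ c ∷ r)
hasDDpadded _               = false

hasDoubleDescent : List ℕ → Bool
hasDoubleDescent w = hasDDpadded (0 ∷ (w ++ (0 ∷ [])))

-- ends with an ascent (with σ_0 = 0, a one-letter word ends with the ascent 0 < σ_1)
endsWithAscent : List ℕ → Bool
endsWithAscent []          = true
endsWithAscent (a ∷ [])    = 0 <ᵇ a
endsWithAscent (a ∷ b ∷ [])    = a <ᵇ b
endsWithAscent (a ∷ b ∷ c ∷ r) = endsWithAscent (b ∷ c ∷ r)

subword : ℕ → List ℕ → List ℕ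
subword k w = filter (λ a → (a ℕ.≤ᵇ k) ≟ true) w

isAndre : ℕ → List ℕ → Bool
isAndre n σ = allB (λ k → not (hasDoubleDescent (subword k σ)) ∧ endsWithAscent (subword k σ)) (range n)

andre : ℕ → List (List ℕ)
andre n = filter (λ σ → isAndre n σ ≟ true) (perms n)

andreK : ℕ → ℕ → List (List ℕ)
andreK n k = filter (λ σ → (des σ ≡ᵇ k) ≟ true) (andre n)

-- Algebra in an arbitrary commutative semiring (a polynomial identity in
-- ℕ[p,q,t] is the same as an identity in every commutative semiring).

module _ {c ℓ : Level} (R : CommutativeSemiring c ℓ) where
  open CommutativeSemiring R renaming (Carrier to C)

  pw : C → ℕ → C
  pw a zero    = 1#
  pw a (suc k) = a * pw a k

  sumTo : ℕ → (ℕ → C) → C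
  sumTo zero    f = 0#
  sumTo (suc n) f = sumTo n f + f n

  sumList : {A : Set} → (A → C) → List A → C
  sumList f = foldr (λ a s → f a + s) 0#

  qint : C → C → ℕ → C
  qint p q n = sumTo n (λ i → pw p i * pw q (n ∸ suc i))

  -- (p,q)-binomial coefficients via the (p,q)-Pascal recurrence
  -- binom n k = p^k binom (n-1) k + q^(n-k) binom (n-1) (k-1)
  qbinom : C → C → ℕ → ℕ → C
  qbinom p q zero    zero    = 1#
  qbinom p q zero    (suc k) = 0#
  qbinom p q (suc n) zero    = 1#
  qbinom p q (suc n) (suc k) =
    pw p (suc k) * qbinom p q n (suc k) + pw q (n ∸ k) * qbinom p q n k

  Series : Set c
  Series = ℕ → C

  one : Series
  one zero    = 1#
  one (suc n) = 0#

  _⊛_ : Series → Series → Series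
  (f ⊛ g) n = sumTo (suc n) (λ i → f i * g (n ∸ i))

  spow : Series → ℕ → Series
  spow u zero    = one
  spow u (suc k) = u ⊛ spow u k

  -- 1/(1 - u) = Σ_k u^k for u with zero constant term
  -- (u^k has order ≥ k, so only k ≤ n contributes to the x^n coefficient)
  geom : Series → Series
  geom u n = sumTo (suc n) (λ k → spow u k n)

  -- J-fraction data: b_m = [m+1]_{p,q}, λ_m = binom(m+1,2)_{p,q} t
  -- cf p q t m d : the fraction starting at level m, truncated after d levels
  --   F_m = 1 / (1 - b_m x - λ_{m+1} x^2 F_{m+1}),  truncated tail = 0
  cf : C → C → C → ℕ → ℕ → Series
  cf p q t m zero    = λ _ → 0#
  cf p q t m (suc d) = geom u
    where
    u : Series
    u zero          = 0#
    u (suc zero)    = qint p q (suc m)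
    u (suc (suc k)) = qbinom p q (suc (suc m)) 2 * t * cf p q t (suc m) d k

  -- D_{n+1}(p,q,t) = [x^n] of the J-fraction; truncation at depth n+1
  -- already determines the x^n coefficient.
  D : C → C → C → ℕ → C
  D p q t zero    = 0#
  D p q t (suc n) = cf p q t 0 (suc n) n

  dnk : C → C → ℕ → ℕ → C
  dnk p q n k = sumList (λ σ → pw p (res σ) * pw q (les σ ∸ k)) (andreK n k)

  middleSum : C → C → C → ℕ → C
  middleSum p q t n = sumTo (suc ⌊ n ∸ 1 /2⌋) (λ k → dnk p q n k * pw t k)

  andreSum : C → C → C → ℕ → C
  andreSum p q t n =
    sumList (λ σ → pw p (res σ) * pw q (les σ ∸ des σ) * pw t (des σ)) (andre n)

{-# OPTIONS --safe #-}
module Submission where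

-- Build an André permutation by inserting 1, 2, …, n in turn.  At each stage the
-- larger letters still to come form runs, the slots, and the word made of the
-- present letters and the slots fixes the statistics acquired so far: inserting
-- a letter into a slot adds the number of slots to its left to les and the number
-- of slots to its right to res, and it adds a descent exactly when it splits the
-- slot.  The André condition forbids the slot before a letter that exceeds its
-- successor in the present subword; this forbidden slot disappears as soon as
-- something is inserted after that letter.
--
-- So the generating function is a sum over insertion histories whose states are
-- words in allowed and forbidden slots.  The number of slots alone is not a
-- Markovian state, but there is a weight on states, namely
-- [m]!/(p + q)^h for m slots of which h are forbidden, that is an eigenvector of
-- filling, extending and splitting, with eigenvalues 1, [m] and binom(m+1,2)
-- respectively.  Hence only weighted Motzkin paths in m remain, and the
-- first-passage decomposition of these is the J-fraction.

open import Defs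
open import Level using (Level)
open import Algebra.Bundles using (CommutativeSemiring)
open import Data.Bool.Base using (Bool; true; false; _∧_; _∨_; not; if_then_else_; T)
open import Data.Bool.Properties
  using (T-≡; ¬-not; ∧-zeroʳ; ∧-conicalˡ; ∧-conicalʳ; ∨-conicalˡ; ∨-conicalʳ)
  renaming (_≟_ to _≟ᵇ_)
open import Data.List.Base using (List; []; _∷_; _++_; map; concatMap; drop; filter; length; upTo)
open import Data.List.Membership.Propositional using (_∈_; _∉_; find; lose)
open import Data.List.Membership.Propositional.Properties
  using (∈-map⁺; ∈-map⁻; ∈-++⁺ˡ; ∈-++⁺ʳ; ∈-filter⁺; ∈-filter⁻; ∈-upTo⁺; ∈-upTo⁻; ∈-∃++;
         ∈-concatMap⁺; ∈-concatMap⁻)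
open import Data.List.Membership.Propositional.Properties.WithK using (unique∧set⇒bag)
open import Data.List.Properties
  using (map-id; map-++; length-map; length-upTo; upTo-∷ʳ; ∷-injectiveˡ; ∷-injectiveʳ;
         filter-accept; filter-reject)
open import Data.List.Relation.Binary.BagAndSetEquality using (∼bag⇒↭)
import Data.List.Relation.Binary.Permutation.Propositional as ↭
open ↭ using (_↭_)
open import Data.List.Relation.Binary.Permutation.Propositional.Properties
  using (∈-resp-↭; ↭-length)
import Data.List.Relation.Binary.Permutation.Setoid.Properties as ↭ₛ
open import Data.List.Relation.Unary.All as All using (All; []; _∷_)
import Data.List.Relation.Unary.All.Properties as Allₚ
open import Data.List.Relation.Unary.AllPairs using ([]; _∷_)
open import Data.List.Relation.Unary.Any using (here; there)
open import Data.List.Relation.Unary.Unique.Propositional using (Unique)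
import Data.List.Relation.Unary.Unique.Propositional.Properties as Uniqueₚ
open import Data.Nat.Base as ℕ
  using (ℕ; zero; suc; _∸_; _≤_; _<_; _≤ᵇ_; _<ᵇ_; _≡ᵇ_; z≤n; s≤s; s≤s⁻¹; pred; ⌊_/2⌋)
import Data.Nat.Properties as ℕₚ
open import Data.Nat.Solver using (module +-*-Solver)
open import Data.Product using (_×_; _,_; proj₁; proj₂; ∃-syntax)
open import Data.Sum using (inj₁; inj₂)
open import Data.Unit using (⊤; tt)
open import Function.Base using (_∘_; id)
open import Function.Bundles using (Equivalence; mk⇔)
open import Relation.Binary.Definitions using (tri<; tri≈; tri>)
import Relation.Binary.PropositionalEquality as ≡
open ≡ using (_≡_; _≢_)
open import Relation.Nullary using (¬_; yes; no; does; contradiction)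
open import Relation.Nullary.Decidable using (dec-true; dec-false)


-- The factor (p + q)^(-h) has a local origin. If all m slots were free, the factors p^r q^l of the
-- possible positions would add up to [m]. A hook with r slots to its right blocks its left slot,
-- and an insertion into its right slot dissolves it; the q owed to the left slot is then spent, so
-- the hook contributes p^r where two free slots would contribute p^(r+1) + q p^r = (p + q) p^r.
-- Hence dissolving a hook must be worth p + q. The eigenvalues follow: filling gives [m]/[m] = 1,
-- extending gives [m], and splitting, which adds a slot and a hook, gives [m][m+1]/(p + q).
--
-- A split creates its descent at once, while the unit of les that pays for it arrives only when the
-- hook dissolves. So the invariant is les + hooks = des + e, with e the exponent of q. A word
-- without slots has no hooks, so les - des is nonnegative there and truncated subtraction is exact.
--
-- In an arbitrary commutative semiring p + q can be neither inverted nor cancelled. This is why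
-- potentials and eigenvalue equations appear as division-free identities between [m] and
-- binom(m,2).

module Skeletons where

  -- Skeletons, moves and valid states.

  open import Data.Nat.Base using (_+_)
  open ℕₚ hiding (_≟_)
  open ≡ hiding ([_])
  open ↭ using (↭-refl; ↭-sym; ↭-trans; ↭-prep; ↭-swap; ↭-reflexive; ↭⇒↭ₛ)
  open import Algebra.Properties.CommutativeSemigroup +-commutativeSemigroup using (x∙yz≈y∙xz)
  open import Data.List.Relation.Binary.Permutation.Propositional.Properties using (shift; ∷↭∷ʳ)

  -- A skeleton is a word in which every maximal run of large letters has been
  -- replaced by a slot.  hook b stands for a slot, the letter b and a slot, where
  -- b exceeds the next small letter: nothing may be inserted right before b.
  data Token : Set where
    letter : ℕ → Token
    slot   : Token
    hook   : ℕ → Token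

  Skeleton : Set
  Skeleton = List Token

  letters : Skeleton → List ℕ
  letters []             = []
  letters (letter a ∷ S) = a ∷ letters S
  letters (slot ∷ S)     = letters S
  letters (hook b ∷ S)   = b ∷ letters S

  slots : Skeleton → ℕ
  slots []             = 0
  slots (letter a ∷ S) = slots S
  slots (slot ∷ S)     = suc (slots S)
  slots (hook b ∷ S)   = suc (suc (slots S))

  -- Larger letters may remain nowhere around x, after x only, or on both sides. They cannot remain
  -- before x only: the last of them, x, and the smaller letter after x (or the closing 0) would
  -- form a double descent.
  data Kind : Set where
    fill extend split : Kind

  place : Kind → ℕ → Skeleton → Skeleton
  place fill   x S = letter x ∷ S
  place extend x S = letter x ∷ slot ∷ S
  place split  x S = hook x ∷ S

  -- The two numbers are the exponents contributed to p and q: the number of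
  -- slots to the right, and the number of slots to the left, less one when the
  -- insertion dissolves a hook.
  data Move (x : ℕ) : Kind → ℕ → ℕ → Skeleton → Skeleton → Set where
    at-slot      : ∀ κ {S} → Move x κ (slots S) 0 (slot ∷ S) (place κ x S)
    at-hook      : ∀ κ {b S} →
                   Move x κ (slots S) 0 (hook b ∷ S) (slot ∷ letter b ∷ place κ x S)
    under-letter : ∀ {κ r l a S S′} → Move x κ r l S S′ →
                   Move x κ r l (letter a ∷ S) (letter a ∷ S′)
    under-slot   : ∀ {κ r l S S′} → Move x κ r l S S′ →
                   Move x κ r (suc l) (slot ∷ S) (slot ∷ S′)
    under-hook   : ∀ {κ r l b S S′} → Move x κ r l S S′ →
                   Move x κ r (suc (suc l)) (hook b ∷ S) (hook b ∷ S′)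

  Option : Set
  Option = Kind × ℕ × ℕ × Skeleton

  beneath : Token → ℕ → Option → Option
  beneath τ d (κ , r , l , S) = κ , r , d + l , τ ∷ S

  placements : ℕ → Skeleton → Skeleton → List Option
  placements x U S = opt fill ∷ opt extend ∷ opt split ∷ []
    where
    opt : Kind → Option
    opt κ = κ , slots S , 0 , U ++ place κ x S

  moves : ℕ → Skeleton → List Option
  moves x []             = []
  moves x (letter a ∷ S) = map (beneath (letter a) 0) (moves x S)
  moves x (slot ∷ S)     =
    placements x [] S ++ map (beneath slot 1) (moves x S)
  moves x (hook b ∷ S)   =
    placements x (slot ∷ letter b ∷ []) S ++ map (beneath (hook b) 2) (moves x S)

  ∈-placements : ∀ x U S κ → (κ , slots S , 0 , U ++ place κ x S) ∈ placements x U S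
  ∈-placements x U S fill   = here refl
  ∈-placements x U S extend = there (here refl)
  ∈-placements x U S split  = there (there (here refl))

  ∈-moves⁺ : ∀ {x κ r l S S′} → Move x κ r l S S′ → (κ , r , l , S′) ∈ moves x S
  ∈-moves⁺ {x} (at-slot κ {S})     = ∈-++⁺ˡ (∈-placements x [] S κ)
  ∈-moves⁺ {x} (at-hook κ {b} {S}) = ∈-++⁺ˡ (∈-placements x (slot ∷ letter b ∷ []) S κ)
  ∈-moves⁺ (under-letter m)        = ∈-map⁺ _ (∈-moves⁺ m)
  ∈-moves⁺ {x} (under-slot {S = S} m) = ∈-++⁺ʳ (placements x [] S) (∈-map⁺ _ (∈-moves⁺ m))
  ∈-moves⁺ {x} (under-hook {b = b} {S} m) =
    ∈-++⁺ʳ (placements x (slot ∷ letter b ∷ []) S) (∈-map⁺ _ (∈-moves⁺ m))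

  ∈-moves⁻ : ∀ {x} S {κ r l S′} → (κ , r , l , S′) ∈ moves x S → Move x κ r l S S′
  ∈-moves⁻ (letter a ∷ S) m with _ , m′ , refl ← ∈-map⁻ _ m = under-letter (∈-moves⁻ S m′)
  ∈-moves⁻ (slot ∷ S) (here refl)                 = at-slot fill
  ∈-moves⁻ (slot ∷ S) (there (here refl))         = at-slot extend
  ∈-moves⁻ (slot ∷ S) (there (there (here refl))) = at-slot split
  ∈-moves⁻ (slot ∷ S) (there (there (there m)))
    with _ , m′ , refl ← ∈-map⁻ _ m = under-slot (∈-moves⁻ S m′)
  ∈-moves⁻ (hook b ∷ S) (here refl)                 = at-hook fill
  ∈-moves⁻ (hook b ∷ S) (there (here refl))         = at-hook extend
  ∈-moves⁻ (hook b ∷ S) (there (there (here refl))) = at-hook split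
  ∈-moves⁻ (hook b ∷ S) (there (there (there m)))
    with _ , m′ , refl ← ∈-map⁻ _ m = under-hook (∈-moves⁻ S m′)

  -- first [] = 0 plays the part of the closing letter σ_{n+1} = 0.
  first : List ℕ → ℕ
  first []      = 0
  first (a ∷ _) = a

  -- The weak inequality settles the end of the word: the empty word rises, so a slot at the very
  -- end is free, while a single positive letter does not rise, being followed by 0.
  Rises : List ℕ → Set
  Rises w = first w ≤ first (drop 1 w)

  Smooth : List ℕ → Set
  Smooth []      = ⊤
  Smooth (a ∷ w) = (first w < a → Rises w) × Smooth w

  data Unslotted : Skeleton → Set where
    []     : Unslotted []
    letter : ∀ {a S} → Unslotted (letter a ∷ S)

  -- The normal forms met by insertion histories when x is the next letter: no two slots touch, and
  -- a free slot stands only before a rise or at the end. In `hook`, the inequality is what blocks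
  -- the left slot, and `Rises` is what frees the right one.
  data Valid (x : ℕ) : Skeleton → Set where
    []     : Valid x []
    letter : ∀ {a S} → a < x → (first (letters S) < a → Rises (letters S)) →
             Valid x S → Valid x (letter a ∷ S)
    slot   : ∀ {S} → Unslotted S → Rises (letters S) → Valid x S → Valid x (slot ∷ S)
    hook   : ∀ {b S} → b < x → first (letters S) < b → Unslotted S → Rises (letters S) →
             Valid x S → Valid x (hook b ∷ S)

  letters< : ∀ {x S} → Valid x S → All (_< x) (letters S)
  letters< []                 = []
  letters< (letter a<x _ v)   = a<x ∷ letters< v
  letters< (slot _ _ v)       = letters< v
  letters< (hook b<x _ _ _ v) = b<x ∷ letters< v

  first< : ∀ {x w} → 0 < x → All (_< x) w → first w < x
  first< 0<x []        = 0<x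
  first< 0<x (a<x ∷ _) = a<x

  Valid⇒Smooth : ∀ {x S} → Valid x S → Smooth (letters S)
  Valid⇒Smooth []               = tt
  Valid⇒Smooth (letter _ ok v)  = ok , Valid⇒Smooth v
  Valid⇒Smooth (slot _ _ v)     = Valid⇒Smooth v
  Valid⇒Smooth (hook _ _ _ ↗ v) = (λ _ → ↗) , Valid⇒Smooth v

  Valid-suc : ∀ {x S} → Valid x S → Valid (suc x) S
  Valid-suc []                 = []
  Valid-suc (letter a<x ok v)  = letter (m<n⇒m<1+n a<x) ok (Valid-suc v)
  Valid-suc (slot u ↗ v)       = slot u ↗ (Valid-suc v)
  Valid-suc (hook b<x d u ↗ v) = hook (m<n⇒m<1+n b<x) d u ↗ (Valid-suc v)

  data Insert (x : ℕ) : List ℕ → List ℕ → Set where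
    here  : ∀ {w} → Insert x w (x ∷ w)
    there : ∀ {a w w′} → Insert x w w′ → Insert x (a ∷ w) (a ∷ w′)

  Insert⇒↭ : ∀ {x w w′} → Insert x w w′ → w′ ↭ x ∷ w
  Insert⇒↭ here      = ↭-refl
  Insert⇒↭ (there i) = ↭-trans (↭-prep _ (Insert⇒↭ i)) (↭-swap _ _ ↭-refl)

  place-insert : ∀ κ {x S} → Insert x (letters S) (letters (place κ x S))
  place-insert fill   = here
  place-insert extend = here
  place-insert split  = here

  Move-insert : ∀ {x κ r l S S′} → Move x κ r l S S′ → Insert x (letters S) (letters S′)
  Move-insert (at-slot κ)      = place-insert κ
  Move-insert (at-hook κ)      = there (place-insert κ)
  Move-insert (under-letter m) = there (Move-insert m)
  Move-insert (under-slot m)   = Move-insert m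
  Move-insert (under-hook m)   = there (Move-insert m)

  insert-first : ∀ {x w w′} → Insert x w w′ → All (_< x) w → first w ≤ first w′
  insert-first here      []        = z≤n
  insert-first here      (a<x ∷ _) = <⇒≤ a<x
  insert-first (there i) _         = ≤-refl

  -- A new maximum placed right after `a` removes the descent there; placed further on, it keeps the
  -- first letter and can only raise the second.
  insert-rises : ∀ {x w w′ a} → Insert x w w′ → All (_< x) w → a < x →
    (first w < a → Rises w) → first w′ < a → Rises w′
  insert-rises here      _          a<x ok x<a = contradiction x<a (<-asym a<x)
  insert-rises (there i) (_ ∷ w<x) a<x ok b<a = ≤-trans (ok b<a) (insert-first i w<x)

  place-valid : ∀ κ {x S} → 0 < x → Unslotted S → Rises (letters S) → Valid x S →
                Valid (suc x) (place κ x S)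
  place-valid fill   0<x u ↗ v = letter ≤-refl (λ _ → ↗) (Valid-suc v)
  place-valid extend 0<x u ↗ v = letter ≤-refl (λ _ → ↗) (slot u ↗ (Valid-suc v))
  place-valid split  0<x u ↗ v = hook ≤-refl (first< 0<x (letters< v)) u ↗ (Valid-suc v)

  place-first : ∀ κ {x S} → first (letters (place κ x S)) ≡ x
  place-first fill   = refl
  place-first extend = refl
  place-first split  = refl

  Move-valid : ∀ {x κ r l S S′} → 0 < x → Move x κ r l S S′ → Valid x S → Valid (suc x) S′
  Move-valid 0<x (at-slot κ) (slot u ↗ v) = place-valid κ 0<x u ↗ v
  Move-valid {x} 0<x (at-hook κ {b} {S}) (hook b<x d u ↗ v) =
    slot letter b≤ (letter (m<n⇒m<1+n b<x)
      (λ x<b → contradiction (subst (_< _) (place-first κ {x} {S}) x<b) (<-asym b<x))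
      (place-valid κ 0<x u ↗ v))
    where
    b≤ : b ≤ first (letters (place κ x S))
    b≤ = subst (b ≤_) (sym (place-first κ {x} {S})) (<⇒≤ b<x)
  Move-valid 0<x (under-letter m) (letter a<x ok v) =
    letter (m<n⇒m<1+n a<x) (insert-rises (Move-insert m) (letters< v) a<x ok) (Move-valid 0<x m v)
  Move-valid 0<x (under-slot (under-letter m)) (slot letter ↗ v@(letter _ _ v′)) =
    slot letter (≤-trans ↗ (insert-first (Move-insert m) (letters< v′)))
      (Move-valid 0<x (under-letter m) v)
  Move-valid 0<x (under-hook (under-letter m)) (hook b<x d letter ↗ v@(letter _ _ v′)) =
    hook (m<n⇒m<1+n b<x) d letter (≤-trans ↗ (insert-first (Move-insert m) (letters< v′)))
      (Move-valid 0<x (under-letter m) v)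

  -- Reading the skeleton of each stage off a word.

  openSlot : Skeleton → Skeleton
  openSlot (slot ∷ S)            = slot ∷ S
  openSlot (hook b ∷ S)          = hook b ∷ S
  -- A large letter is being prepended. It completes a hook exactly when b has large letters after
  -- it and exceeds the next small letter.
  openSlot (letter b ∷ slot ∷ S) =
    if does (first (letters S) <? b) then hook b ∷ S else slot ∷ letter b ∷ slot ∷ S
  openSlot S                     = slot ∷ S

  skeleton : ℕ → List ℕ → Skeleton
  skeleton x []      = []
  skeleton x (a ∷ w) =
    if does (a ≤? x) then letter a ∷ skeleton x w else openSlot (skeleton x w)

  openSlot-hook : ∀ {b S} → first (letters S) < b → openSlot (letter b ∷ slot ∷ S) ≡ hook b ∷ S
  openSlot-hook {b} {S} d rewrite dec-true (first (letters S) <? b) d = refl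

  openSlot-slot : ∀ {b S} → b ≤ first (letters S) →
                  openSlot (letter b ∷ slot ∷ S) ≡ slot ∷ letter b ∷ slot ∷ S
  openSlot-slot {b} {S} b≤ rewrite dec-false (first (letters S) <? b) (≤⇒≯ b≤) = refl

  skeleton-≤ : ∀ {x a} w → a ≤ x → skeleton x (a ∷ w) ≡ letter a ∷ skeleton x w
  skeleton-≤ {x} {a} _ a≤x rewrite dec-true (a ≤? x) a≤x = refl

  skeleton-> : ∀ {x a} w → x < a → skeleton x (a ∷ w) ≡ openSlot (skeleton x w)
  skeleton-> {x} {a} _ x<a rewrite dec-false (a ≤? x) (<⇒≱ x<a) = refl

  skeleton-∷ : ∀ x a w w′ → skeleton x w ≡ skeleton x w′ → skeleton x (a ∷ w) ≡ skeleton x (a ∷ w′)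
  skeleton-∷ x a w w′ = cong (λ S → if does (a ≤? x) then letter a ∷ S else openSlot S)

  openSlot-idem : ∀ S → openSlot (openSlot S) ≡ openSlot S
  openSlot-idem []                         = refl
  openSlot-idem (slot ∷ S)                 = refl
  openSlot-idem (hook b ∷ S)               = refl
  openSlot-idem (letter b ∷ [])            = refl
  openSlot-idem (letter b ∷ letter c ∷ S)  = refl
  openSlot-idem (letter b ∷ hook c ∷ S)    = refl
  openSlot-idem (letter b ∷ slot ∷ S) with does (first (letters S) <? b)
  ... | true  = refl
  ... | false = refl

  letters-openSlot : ∀ S → letters (openSlot S) ≡ letters S
  letters-openSlot []                         = refl
  letters-openSlot (slot ∷ S)                 = refl
  letters-openSlot (hook b ∷ S)               = refl
  letters-openSlot (letter b ∷ [])            = refl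
  letters-openSlot (letter b ∷ letter c ∷ S)  = refl
  letters-openSlot (letter b ∷ hook c ∷ S)    = refl
  letters-openSlot (letter b ∷ slot ∷ S) with does (first (letters S) <? b)
  ... | true  = refl
  ... | false = refl

  ≤⇒≤ᵇ≡true : ∀ {a x} → a ≤ x → (a ≤ᵇ x) ≡ true
  ≤⇒≤ᵇ≡true = Equivalence.to T-≡ ∘ ≤⇒≤ᵇ

  ≤ᵇ≡true⇒≤ : ∀ {a x} → (a ≤ᵇ x) ≡ true → a ≤ x
  ≤ᵇ≡true⇒≤ {a} {x} = ≤ᵇ⇒≤ a x ∘ Equivalence.from T-≡

  subword-≤ : ∀ {x a} w → a ≤ x → subword x (a ∷ w) ≡ a ∷ subword x w
  subword-≤ {x} w a≤x = filter-accept (λ a → (a ≤ᵇ x) ≟ᵇ true) (≤⇒≤ᵇ≡true a≤x)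

  subword-> : ∀ {x a} w → x < a → subword x (a ∷ w) ≡ subword x w
  subword-> {x} {a} w x<a =
    filter-reject (λ a → (a ≤ᵇ x) ≟ᵇ true) {a} {w} (<⇒≱ x<a ∘ ≤ᵇ≡true⇒≤)

  letters-skeleton : ∀ x w → letters (skeleton x w) ≡ subword x w
  letters-skeleton x [] = refl
  letters-skeleton x (a ∷ w) with a ≤? x
  ... | yes a≤x = trans (cong letters (skeleton-≤ w a≤x))
                    (trans (cong (a ∷_) (letters-skeleton x w)) (sym (subword-≤ w a≤x)))
  ... | no a≰x  = trans (cong letters (skeleton-> w (≰⇒> a≰x)))
                    (trans (letters-openSlot (skeleton x w))
                      (trans (letters-skeleton x w) (sym (subword-> w (≰⇒> a≰x)))))

  -- With a letter N above all others in place of every slot, the statistics of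
  -- words apply to unfinished permutations.
  word : ℕ → Skeleton → List ℕ
  word N []             = []
  word N (letter a ∷ S) = a ∷ word N S
  word N (slot ∷ S)     = N ∷ word N S
  word N (hook b ∷ S)   = N ∷ b ∷ N ∷ word N S

  openSlot-unslotted : ∀ {S} → Unslotted S → Rises (letters S) → openSlot S ≡ slot ∷ S
  openSlot-unslotted []                            ↗ = refl
  openSlot-unslotted (letter {S = []})             ↗ = refl
  openSlot-unslotted (letter {S = letter c ∷ S})   ↗ = refl
  openSlot-unslotted (letter {S = hook c ∷ S})     ↗ = refl
  openSlot-unslotted (letter {b} {S = slot ∷ S})   ↗ = openSlot-slot {b} {S} ↗

  -- Valid skeletons are normal forms, so nothing is lost by passing to words. The recovery of a
  -- history from its final word rests on this.
  skeleton-word : ∀ {x N S} → x < N → Valid (suc x) S → skeleton x (word N S) ≡ S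
  skeleton-word x<N [] = refl
  skeleton-word {x} {N} x<N (letter {S = S} a≤x _ v) =
    trans (skeleton-≤ (word N S) (s≤s⁻¹ a≤x)) (cong (_ ∷_) (skeleton-word x<N v))
  skeleton-word {x} {N} x<N (slot {S} u ↗ v) = trans (skeleton-> (word N S) x<N)
    (trans (cong openSlot (skeleton-word x<N v)) (openSlot-unslotted u ↗))
  skeleton-word {x} {N} x<N (hook {b} {S} b≤x d u ↗ v) = begin
    skeleton x (N ∷ b ∷ N ∷ word N S)
      ≡⟨ skeleton-> (b ∷ N ∷ word N S) x<N ⟩
    openSlot (skeleton x (b ∷ N ∷ word N S))
      ≡⟨ cong openSlot (skeleton-≤ (N ∷ word N S) (s≤s⁻¹ b≤x)) ⟩
    openSlot (letter b ∷ skeleton x (N ∷ word N S))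
      ≡⟨ cong (openSlot ∘ (letter b ∷_)) (trans (skeleton-> (word N S) x<N)
           (trans (cong openSlot (skeleton-word x<N v)) (openSlot-unslotted u ↗))) ⟩
    openSlot (letter b ∷ slot ∷ S)
      ≡⟨ openSlot-hook {b} {S} d ⟩
    hook b ∷ S ∎
    where open ≡-Reasoning

  module _ {x y N : ℕ} (y<x : y < x) (x<N : x < N) where

    skeleton-NN : ∀ w → skeleton y (N ∷ N ∷ w) ≡ skeleton y (N ∷ w)
    skeleton-NN w = begin
      skeleton y (N ∷ N ∷ w)             ≡⟨ skeleton-> (N ∷ w) y<N ⟩
      openSlot (skeleton y (N ∷ w))      ≡⟨ cong openSlot (skeleton-> w y<N) ⟩
      openSlot (openSlot (skeleton y w)) ≡⟨ openSlot-idem (skeleton y w) ⟩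
      openSlot (skeleton y w)            ≡⟨ skeleton-> w y<N ⟨
      skeleton y (N ∷ w)                 ∎
      where
      open ≡-Reasoning
      y<N : y < N
      y<N = <-trans y<x x<N

    skeleton-xN : ∀ w → skeleton y (x ∷ w) ≡ skeleton y (N ∷ w)
    skeleton-xN w = trans (skeleton-> w y<x) (sym (skeleton-> w (<-trans y<x x<N)))

    skeleton-place : ∀ κ S → skeleton y (word N (place κ x S)) ≡ skeleton y (word N (slot ∷ S))
    skeleton-place fill   S = skeleton-xN (word N S)
    skeleton-place extend S = trans (skeleton-xN (N ∷ word N S)) (skeleton-NN (word N S))
    skeleton-place split  S =
      trans (skeleton-∷ y N (x ∷ N ∷ word N S) (N ∷ word N S) (skeleton-place extend S))
        (skeleton-NN (word N S))

    -- At an earlier stage y the letter x is itself large, so a move only rearranges the inside of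
    -- one run of large letters.
    skeleton-move : ∀ {κ r l S S′} → Move x κ r l S S′ →
                    skeleton y (word N S′) ≡ skeleton y (word N S)
    skeleton-move (at-slot κ {S})      = skeleton-place κ S
    skeleton-move (at-hook κ {b} {S})  =
      skeleton-∷ y N (b ∷ P) (b ∷ N ∷ word N S)
        (skeleton-∷ y b P (N ∷ word N S) (skeleton-place κ S))
      where P = word N (place κ x S)
    skeleton-move (under-letter {a = a} {S} {S′} m) =
      skeleton-∷ y a (word N S′) (word N S) (skeleton-move m)
    skeleton-move (under-slot {S = S} {S′} m) =
      skeleton-∷ y N (word N S′) (word N S) (skeleton-move m)
    skeleton-move (under-hook {b = b} {S} {S′} m) =
      skeleton-∷ y N (b ∷ N ∷ word N S′) (b ∷ N ∷ word N S)
        (skeleton-∷ y b (N ∷ word N S′) (N ∷ word N S)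
          (skeleton-∷ y N (word N S′) (word N S) (skeleton-move m)))

  -- Fillings: finished words and the uniqueness of their histories.

  result : Option → Skeleton
  result (_ , _ , _ , S) = S

  fillings : ℕ → ℕ → Skeleton → List (List ℕ)
  fillings zero    x S = if slots S ≡ᵇ 0 then letters S ∷ [] else []
  fillings (suc k) x S = concatMap (fillings k (suc x) ∘ result) (moves x S)

  word-slotless : ∀ N S → slots S ≡ 0 → word N S ≡ letters S
  word-slotless N []             _  = refl
  word-slotless N (letter a ∷ S) eq = cong (a ∷_) (word-slotless N S eq)

  ∈-fillings⁻ : ∀ k {x S σ} → σ ∈ fillings (suc k) x S →
    ∃[ κ ] ∃[ r ] ∃[ l ] ∃[ S′ ] (Move x κ r l S S′ × σ ∈ fillings k (suc x) S′)
  ∈-fillings⁻ k {x} {S} σ∈ with find (∈-concatMap⁻ (fillings k (suc x) ∘ result) {xs = moves x S} σ∈)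
  ... | (κ , r , l , S′) , o∈ , σ∈′ = κ , r , l , S′ , ∈-moves⁻ S o∈ , σ∈′

  ∈-fillings-zero : ∀ {x} N S {σ} → σ ∈ fillings zero x S → σ ≡ word N S × σ ≡ letters S
  ∈-fillings-zero N S σ∈ with slots S in eq
  ∈-fillings-zero N S (here refl) | zero = sym (word-slotless N S eq) , refl

  module _ {N : ℕ} where

    fillings-skeleton : ∀ k {x S σ} → k + x ≤ N → σ ∈ fillings k x S →
      ∀ {z} → z < x → skeleton z σ ≡ skeleton z (word N S)
    fillings-skeleton zero {x} {S} _ σ∈ {z} z<x = cong (skeleton z) (proj₁ (∈-fillings-zero {x} N S σ∈))
    fillings-skeleton (suc k) {x} {S} k+x≤N σ∈ z<x with ∈-fillings⁻ k {S = S} σ∈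
    ... | _ , _ , _ , S′ , m , σ∈′ = trans
      (fillings-skeleton k {S = S′} (≤-trans (≤-reflexive (+-suc k x)) k+x≤N) σ∈′ (m<n⇒m<1+n z<x))
      (skeleton-move z<x (≤-trans (s≤s (m≤n+m x k)) k+x≤N) m)

    -- Subwords of earlier stages are frozen by `skeleton-move`. The only new one consists of the
    -- letters of the new skeleton, and validity makes it smooth.
    fillings-smooth : ∀ k {y S σ} → k + suc y ≤ N → Valid (suc y) S → σ ∈ fillings k (suc y) S →
      (∀ z → z ≤ y → Smooth (subword z (word N S))) → ∀ z → z ≤ k + y → Smooth (subword z σ)
    fillings-smooth zero {y} {S} _ v σ∈ smooth z z≤y =
      subst (Smooth ∘ subword z) (sym (proj₁ (∈-fillings-zero {suc y} N S σ∈))) (smooth z z≤y)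
    fillings-smooth (suc k) {y} {S} k+x≤N v σ∈ smooth z z≤k+y with ∈-fillings⁻ k {S = S} σ∈
    ... | _ , _ , _ , S′ , m , σ∈′ =
      fillings-smooth k (≤-trans (≤-reflexive (+-suc k (suc y))) k+x≤N) v′ σ∈′ smooth′ z
        (≤-trans z≤k+y (≤-reflexive (sym (+-suc k y))))
      where
      v′ = Move-valid (s≤s z≤n) m v
      x<N : suc y < N
      x<N = ≤-trans (s≤s (m≤n+m (suc y) k)) k+x≤N
      smooth′ : ∀ z → z ≤ suc y → Smooth (subword z (word N S′))
      smooth′ z z≤x with m≤n⇒m<n∨m≡n z≤x
      ... | inj₁ z<x  = subst Smooth (trans (sym (letters-skeleton z (word N S)))
                          (trans (cong letters (sym (skeleton-move z<x x<N m)))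
                            (letters-skeleton z (word N S′))))
                          (smooth z (s≤s⁻¹ z<x))
      ... | inj₂ refl = subst Smooth (trans (sym (cong letters (skeleton-word x<N v′)))
                          (letters-skeleton (suc y) (word N S′))) (Valid⇒Smooth v′)

  ∷-irrefl : ∀ {A : Set} {a : A} {w} → w ≢ a ∷ w
  ∷-irrefl {w = w} eq = 1+n≢n (sym (cong length eq))

  map-result-beneath : ∀ τ d os → map result (map (beneath τ d) os) ≡ map (τ ∷_) (map result os)
  map-result-beneath τ d []       = refl
  map-result-beneath τ d (o ∷ os) = cong (_ ∷_) (map-result-beneath τ d os)

  moves-unique : ∀ x S → Unique (map result (moves x S))
  moves-unique x [] = []
  moves-unique x (letter a ∷ S) = subst Unique (sym (map-result-beneath (letter a) 0 (moves x S)))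
    (Uniqueₚ.map⁺ ∷-injectiveʳ (moves-unique x S))
  moves-unique x (slot ∷ S) rewrite map-result-beneath slot 1 (moves x S) =
    ((∷-irrefl ∘ ∷-injectiveʳ) ∷ (λ ()) ∷ Allₚ.map⁺ (All.universal (λ _ ()) _)) ∷
    ((λ ()) ∷ Allₚ.map⁺ (All.universal (λ _ ()) _)) ∷
    Allₚ.map⁺ (All.universal (λ _ ()) _) ∷
    Uniqueₚ.map⁺ ∷-injectiveʳ (moves-unique x S)
  moves-unique x (hook b ∷ S) rewrite map-result-beneath (hook b) 2 (moves x S) =
    ((∷-irrefl ∘ ∷-injectiveʳ ∘ ∷-injectiveʳ ∘ ∷-injectiveʳ) ∷ (λ ())
      ∷ Allₚ.map⁺ (All.universal (λ _ ()) _)) ∷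
    ((λ ()) ∷ Allₚ.map⁺ (All.universal (λ _ ()) _)) ∷
    Allₚ.map⁺ (All.universal (λ _ ()) _) ∷
    Uniqueₚ.map⁺ ∷-injectiveʳ (moves-unique x S)

  -- The blocks f x are disjoint because ρ recovers π x from any of their members.
  concatMap-unique : ∀ {A B C : Set} (f : A → List B) (π : A → C) (ρ : B → C) xs →
    Unique (map π xs) → (∀ {x} → x ∈ xs → Unique (f x)) →
    (∀ {x y} → x ∈ xs → y ∈ f x → ρ y ≡ π x) → Unique (concatMap f xs)
  concatMap-unique f π ρ [] _ _ _ = []
  concatMap-unique f π ρ (x ∷ xs) (πx∉ ∷ u) uf ρ-f = Uniqueₚ.++⁺ (uf (here refl))
    (concatMap-unique f π ρ xs u (uf ∘ there) (ρ-f ∘ there)) disjoint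
    where
    disjoint : ∀ {y} → ¬ (y ∈ f x × y ∈ concatMap f xs)
    disjoint (y∈fx , y∈) with x′ , x′∈ , y∈′ ← find (∈-concatMap⁻ f {xs = xs} y∈) =
      All.lookup πx∉ (∈-map⁺ π x′∈) (trans (sym (ρ-f (here refl) y∈fx)) (ρ-f (there x′∈) y∈′))

  -- `skeleton x` applied to a finished word returns the state right after x was inserted, so
  -- different first moves have disjoint sets of fillings.
  fillings-unique : ∀ {N} k {x S} → 0 < x → k + x ≤ N → Valid x S → Unique (fillings k x S)
  fillings-unique zero {S = S} _ _ _ with slots S
  ... | zero  = [] ∷ []
  ... | suc _ = []
  fillings-unique {N} (suc k) {x} {S} 0<x k+x≤N v =
    concatMap-unique (fillings k (suc x) ∘ result) result (skeleton x) (moves x S) (moves-unique x S)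
      (λ o∈ → fillings-unique k (s≤s z≤n) k+x≤N′ (valid o∈))
      (λ {o} o∈ σ∈ → trans (fillings-skeleton k {S = result o} k+x≤N′ σ∈ ≤-refl)
        (skeleton-word (≤-trans (s≤s (m≤n+m x k)) k+x≤N) (valid o∈)))
    where
    k+x≤N′ : k + suc x ≤ N
    k+x≤N′ = ≤-trans (≤-reflexive (+-suc k x)) k+x≤N
    valid : ∀ {o} → o ∈ moves x S → Valid (suc x) (result o)
    valid o∈ = Move-valid 0<x (∈-moves⁻ S o∈) v

  -- Every word that is smooth at all stages comes from a history.

  data Formed : Skeleton → Set where
    []     : Formed []
    letter : ∀ {a S} → Formed S → Formed (letter a ∷ S)
    slot   : ∀ {S} → Unslotted S → Formed S → Formed (slot ∷ S)
    hook   : ∀ {b S} → first (letters S) < b → Unslotted S → Formed S → Formed (hook b ∷ S)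

  data Slotted : Skeleton → Set where
    slot : ∀ {S} → Slotted (slot ∷ S)
    hook : ∀ {b S} → Slotted (hook b ∷ S)

  openSlot-slotted : ∀ S → Slotted (openSlot S)
  openSlot-slotted []                        = slot
  openSlot-slotted (slot ∷ S)                = slot
  openSlot-slotted (hook b ∷ S)              = hook
  openSlot-slotted (letter b ∷ [])           = slot
  openSlot-slotted (letter b ∷ letter c ∷ S) = slot
  openSlot-slotted (letter b ∷ hook c ∷ S)   = slot
  openSlot-slotted (letter b ∷ slot ∷ S) with first (letters S) <? b
  ... | yes d = subst Slotted (sym (openSlot-hook {b} {S} d)) hook
  ... | no ≮b = subst Slotted (sym (openSlot-slot {b} {S} (≮⇒≥ ≮b))) slot

  openSlot-formed : ∀ {S} → Formed S → Formed (openSlot S)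
  openSlot-formed []                      = slot [] []
  openSlot-formed f@(slot _ _)            = f
  openSlot-formed f@(hook _ _ _)          = f
  openSlot-formed f@(letter [])           = slot letter f
  openSlot-formed f@(letter (letter _))   = slot letter f
  openSlot-formed f@(letter (hook _ _ _)) = slot letter f
  openSlot-formed f@(letter {b} (slot {S} u f′)) with first (letters S) <? b
  ... | yes d = subst Formed (sym (openSlot-hook {b} {S} d)) (hook d u f′)
  ... | no ≮b = subst Formed (sym (openSlot-slot {b} {S} (≮⇒≥ ≮b))) (slot letter f)

  -- `Formed` is the part of `Valid` that holds for an arbitrary word: slots are merged and hooks
  -- stand before falls. The conditions `Rises` come from smoothness and enter separately.
  skeleton-formed : ∀ x w → Formed (skeleton x w)
  skeleton-formed x []      = []
  skeleton-formed x (a ∷ w) with a ≤? x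
  ... | yes a≤x = subst Formed (sym (skeleton-≤ w a≤x)) (letter (skeleton-formed x w))
  ... | no a≰x  = subst Formed (sym (skeleton-> w (≰⇒> a≰x))) (openSlot-formed (skeleton-formed x w))

  Reach : ℕ → Skeleton → Skeleton → Set
  Reach x S S′ = ∃[ κ ] ∃[ r ] ∃[ l ] Move x κ r l S S′

  reach : ∀ {x κ r l S S′} → Move x κ r l S S′ → Reach x S S′
  reach m = _ , _ , _ , m

  first-subword : ∀ y w → first (subword y w) ≤ y
  first-subword y []      = z≤n
  first-subword y (a ∷ w) with a ≤? y
  ... | yes a≤y = subst ((_≤ y) ∘ first) (sym (subword-≤ w a≤y)) a≤y
  ... | no a≰y  = subst ((_≤ y) ∘ first) (sym (subword-> w (≰⇒> a≰y))) (first-subword y w)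

  module _ {x : ℕ} where

    -- The case where x begins its run: it extends if large letters follow and fills otherwise. A
    -- hook cannot follow, since its letter would be a fall.
    reach-letter : ∀ {S} → Formed S → Rises (letters S) → Reach x (openSlot S) (letter x ∷ S)
    reach-letter []                      ↗ = reach (at-slot fill)
    reach-letter (slot _ _)              ↗ = reach (at-slot extend)
    reach-letter (hook d _ _)            ↗ = contradiction d (≤⇒≯ ↗)
    reach-letter (letter [])             ↗ = reach (at-slot fill)
    reach-letter (letter (letter _))     ↗ = reach (at-slot fill)
    reach-letter (letter (hook _ _ _))   ↗ = reach (at-slot fill)
    reach-letter (letter {b} (slot {S} _ _)) ↗ =
      subst (λ T → Reach x T (letter x ∷ letter b ∷ slot ∷ S)) (sym (openSlot-slot {b} {S} ↗))
        (reach (at-slot fill))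

    -- The case where a large letter precedes x: then one must follow as well, and the move is a
    -- split.
    reach-hook : ∀ {S} → Slotted S → Formed S → Rises (letters S) → first (letters S) < x →
                 Reach x (openSlot (openSlot S)) (openSlot (letter x ∷ S))
    reach-hook (slot {S}) f ↗ d = subst (Reach x (slot ∷ S)) (sym (openSlot-hook {x} {S} d))
      (reach (at-slot split))
    reach-hook hook (hook d _ _) ↗ _ = contradiction d (≤⇒≯ ↗)

    openSlot-place : ∀ κ {b S} → openSlot (letter b ∷ place κ x S) ≡ slot ∷ letter b ∷ place κ x S
    openSlot-place fill   = refl
    openSlot-place extend = refl
    openSlot-place split  = refl

    -- Putting a large letter and a small letter z in front of a move may change its constructor: if
    -- z exceeds the next small letter and the move is in the slot right after z, the two tokens
    -- formed a hook and the move dissolves it. Deeper moves keep the comparison of z with its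
    -- successor.
    reach-openSlot : ∀ {κ r l z S S′} → Formed S → Smooth (z ∷ letters S) → Move x κ r l S S′ →
                     Reach x (openSlot (letter z ∷ S)) (openSlot (letter z ∷ S′))
    reach-openSlot {z = z} f sm (at-slot κ {S}) rewrite openSlot-place κ {z} {S}
      with first (letters S) <? z
    ... | yes d rewrite openSlot-hook {z} {S} d         = reach (at-hook κ)
    ... | no ≮z rewrite openSlot-slot {z} {S} (≮⇒≥ ≮z) = reach (under-slot (under-letter (at-slot κ)))
    reach-openSlot {z = z} (hook d _ _) (ok , _) (at-hook κ {b} {S}) =
      subst (Reach x (slot ∷ letter z ∷ hook b ∷ S))
        (sym (openSlot-slot {z} {letter b ∷ place κ x S}
          (≮⇒≥ (λ b<z → contradiction d (≤⇒≯ (ok b<z))))))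
        (reach (under-slot (under-letter (at-hook κ))))
    reach-openSlot f sm (under-letter m) = reach (under-slot (under-letter (under-letter m)))
    reach-openSlot {z = z} (slot letter _) sm (under-slot (under-letter {a = c} {S} {S′} m))
      with c <? z
    ... | yes d rewrite openSlot-hook {z} {letter c ∷ S} d | openSlot-hook {z} {letter c ∷ S′} d =
      reach (under-hook (under-letter m))
    ... | no ≮z rewrite openSlot-slot {z} {letter c ∷ S} (≮⇒≥ ≮z)
                      | openSlot-slot {z} {letter c ∷ S′} (≮⇒≥ ≮z) =
      reach (under-slot (under-letter (under-slot (under-letter m))))
    reach-openSlot f sm (under-hook m) = reach (under-slot (under-letter (under-hook m)))

  skeleton-∉ : ∀ {y} w → suc y ∉ w → skeleton y w ≡ skeleton (suc y) w
  skeleton-∉ []      _  = refl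
  skeleton-∉ {y} (a ∷ w) x∉ with <-cmp a (suc y)
  ... | tri< a<x _ _ = trans (skeleton-≤ w (s≤s⁻¹ a<x))
                         (trans (cong (_ ∷_) (skeleton-∉ w (x∉ ∘ there)))
                           (sym (skeleton-≤ w (<⇒≤ a<x))))
  ... | tri≈ _ refl _ = contradiction (here refl) x∉
  ... | tri> _ _ x<a = trans (skeleton-> w (<-trans ≤-refl x<a))
                         (trans (cong openSlot (skeleton-∉ w (x∉ ∘ there))) (sym (skeleton-> w x<a)))

  head∉ : ∀ {A : Set} {a : A} {w} → Unique (a ∷ w) → a ∉ w
  head∉ (a≢ ∷ _) a∈ = All.lookup a≢ a∈ refl

  ∈-tail : ∀ {A : Set} {a b : A} {w} → a ≢ b → a ∈ b ∷ w → a ∈ w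
  ∈-tail a≢b (here refl) = contradiction refl a≢b
  ∈-tail a≢b (there a∈)  = a∈

  -- The converse of validity: consecutive skeletons of a word differ by one move. Smoothness at
  -- stages y and y + 1 provides the rises that free slots need; smoothness of the whole word
  -- excludes large letters on the left of y + 1 only.
  skeleton-step : ∀ {y} w → suc y ∈ w → Unique w →
    Smooth (subword y w) → Smooth (subword (suc y) w) → Smooth w →
    Reach (suc y) (skeleton y w) (skeleton (suc y) w)
  skeleton-step {y} (z ∷ w) x∈ u@(_ ∷ u′) sy sx s with <-cmp z (suc y)
  ... | tri< z<x _ _
    with _ , _ , _ , m ← skeleton-step w (∈-tail (>⇒≢ z<x) x∈) u′
           (proj₂ (subst Smooth (subword-≤ w (s≤s⁻¹ z<x)) sy))
           (proj₂ (subst Smooth (subword-≤ w (<⇒≤ z<x)) sx)) (proj₂ s)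
    = subst₂ (Reach (suc y)) (sym (skeleton-≤ w (s≤s⁻¹ z<x))) (sym (skeleton-≤ w (<⇒≤ z<x)))
        (reach (under-letter m))
  ... | tri≈ _ refl _ = subst₂ (Reach (suc y))
        (trans (cong openSlot (sym same)) (sym (skeleton-> w ≤-refl))) (sym (skeleton-≤ w ≤-refl))
        (reach-letter (skeleton-formed (suc y) w) rises)
    where
    same : skeleton y w ≡ skeleton (suc y) w
    same = skeleton-∉ w (head∉ u)
    sub : letters (skeleton (suc y) w) ≡ subword y w
    sub = trans (cong letters (sym same)) (letters-skeleton y w)
    rises : Rises (letters (skeleton (suc y) w))
    rises = subst Rises (sym (letters-skeleton (suc y) w))
      (proj₁ (subst Smooth (subword-≤ w ≤-refl) sx)
        (subst (_< suc y) (cong first (trans (sym sub) (letters-skeleton (suc y) w)))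
          (s≤s (first-subword y w))))
  skeleton-step {y} (z ∷ []) (here refl) u sy sx s | tri> _ _ x<z = contradiction x<z (<-irrefl refl)
  skeleton-step {y} (z ∷ v ∷ w) x∈ u@(_ ∷ u′@(_ ∷ u″)) sy sx s | tri> _ _ x<z
    with <-cmp v (suc y) | skeleton-step {y} (v ∷ w)
  ... | tri< v<x _ _ | _
    with sy′ ← subst Smooth (trans (subword-> (v ∷ w) (<-trans ≤-refl x<z))
                 (subword-≤ w (s≤s⁻¹ v<x))) sy
    with sx′ ← subst Smooth (trans (subword-> (v ∷ w) x<z) (subword-≤ w (<⇒≤ v<x))) sx
    with _ , _ , _ , m ← skeleton-step w (∈-tail (>⇒≢ v<x) (∈-tail (<⇒≢ x<z) x∈)) u″
           (proj₂ sy′) (proj₂ sx′) (proj₂ (proj₂ s))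
    = subst₂ (Reach (suc y))
        (sym (trans (skeleton-> (v ∷ w) (<-trans ≤-refl x<z))
          (cong openSlot (skeleton-≤ w (s≤s⁻¹ v<x)))))
        (sym (trans (skeleton-> (v ∷ w) x<z) (cong openSlot (skeleton-≤ w (<⇒≤ v<x)))))
        (reach-openSlot (skeleton-formed y w)
          (subst (Smooth ∘ (v ∷_)) (sym (letters-skeleton y w)) sy′) m)
  ... | tri> _ _ x<v | step
    with reached ← step (∈-tail (<⇒≢ x<z) x∈) u′
           (subst Smooth (subword-> (v ∷ w) (<-trans ≤-refl x<z)) sy)
           (subst Smooth (subword-> (v ∷ w) x<z) sx) (proj₂ s)
    = subst₂ (Reach (suc y)) (same (<-trans ≤-refl x<z) (<-trans ≤-refl x<v)) (same x<z x<v) reached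
    where
    same : ∀ {a} → a < z → a < v → skeleton a (v ∷ w) ≡ skeleton a (z ∷ v ∷ w)
    same {a} a<z a<v = trans (skeleton-> w a<v) (trans (sym (openSlot-idem (skeleton a w)))
      (trans (cong openSlot (sym (skeleton-> w a<v))) (sym (skeleton-> (v ∷ w) a<z))))
  ... | tri≈ _ refl _ | _ = subst₂ (Reach (suc y))
        (trans (cong (openSlot ∘ openSlot) (sym same))
          (sym (trans (skeleton-> (v ∷ w) (<-trans ≤-refl x<z))
          (cong openSlot (skeleton-> w ≤-refl)))))
        (sym (trans (skeleton-> (v ∷ w) x<z) (cong openSlot (skeleton-≤ w ≤-refl))))
        -- Since z exceeds y + 1 and the finished word has no double descent at y + 1, the letter
        -- after y + 1 is larger: this is the slot on the right of the split.
        (reach-hook (slotted w (proj₁ s x<z) (head∉ u′)) (skeleton-formed (suc y) w) rises below)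
    where
    same : skeleton y w ≡ skeleton (suc y) w
    same = skeleton-∉ w (head∉ u′)
    below : first (letters (skeleton (suc y) w)) < suc y
    below = subst ((_< suc y) ∘ first) (trans (sym (letters-skeleton y w)) (cong letters same))
      (s≤s (first-subword y w))
    sx′ : Smooth (suc y ∷ subword (suc y) w)
    sx′ = subst Smooth (trans (subword-> (v ∷ w) x<z) (subword-≤ w ≤-refl)) sx
    rises : Rises (letters (skeleton (suc y) w))
    rises = subst Rises (sym (letters-skeleton (suc y) w))
      (proj₁ sx′ (subst ((_< suc y) ∘ first) (letters-skeleton (suc y) w) below))
    slotted : ∀ w → suc y ≤ first w → suc y ∉ w → Slotted (skeleton (suc y) w)
    slotted (c ∷ w) x≤c x∉ = subst Slotted (sym (skeleton-> w (≤∧≢⇒< x≤c (x∉ ∘ here))))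
      (openSlot-slotted (skeleton (suc y) w))

  subword-all : ∀ {y w} → All (_≤ y) w → subword y w ≡ w
  subword-all []                  = refl
  subword-all {w = a ∷ w} (a≤y ∷ w≤y) = trans (subword-≤ w a≤y) (cong (a ∷_) (subword-all w≤y))

  slots-skeleton : ∀ {y w} → All (_≤ y) w → slots (skeleton y w) ≡ 0
  slots-skeleton []                         = refl
  slots-skeleton {w = a ∷ w} (a≤y ∷ w≤y) = trans (cong slots (skeleton-≤ w a≤y)) (slots-skeleton w≤y)

  ∈-fillings⁺ : ∀ k {y σ} → Unique σ → All (_≤ k + y) σ → (∀ z → y < z → z ≤ k + y → z ∈ σ) →
    (∀ z → z ≤ k + y → Smooth (subword z σ)) → σ ∈ fillings k (suc y) (skeleton y σ)
  ∈-fillings⁺ zero {y} {σ} u σ≤y _ _ rewrite slots-skeleton σ≤y =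
    here (trans (sym (subword-all σ≤y)) (sym (letters-skeleton y σ)))
  ∈-fillings⁺ (suc k) {y} {σ} u σ≤n z∈ smooth
    with _ , _ , _ , m ← skeleton-step σ (z∈ (suc y) ≤-refl (s≤s (m≤n+m y k))) u
           (smooth y (m≤n+m y (suc k))) (smooth (suc y) (s≤s (m≤n+m y k)))
           (subst Smooth (subword-all σ≤n) (smooth (suc k + y) ≤-refl))
    = ∈-concatMap⁺ (fillings k (suc (suc y)) ∘ result) (lose (∈-moves⁺ m)
        (∈-fillings⁺ k u (subst (λ n → All (_≤ n) σ) n≡ σ≤n)
          (λ z y<z z≤ → z∈ z (<-trans ≤-refl y<z) (≤-trans z≤ (≤-reflexive (sym n≡))))
          (λ z z≤ → smooth z (≤-trans z≤ (≤-reflexive (sym n≡))))))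
    where
    n≡ : suc k + y ≡ k + suc y
    n≡ = sym (+-suc k y)

  skeleton-0 : ∀ a w → All (0 <_) (a ∷ w) → skeleton 0 (a ∷ w) ≡ slot ∷ []
  skeleton-0 a []      (0<a ∷ _)  = skeleton-> [] 0<a
  skeleton-0 a (b ∷ w) (0<a ∷ 0<) = trans (skeleton-> (b ∷ w) 0<a) (cong openSlot (skeleton-0 b w 0<))

  -- Change of des, les and res under one insertion.

  <⇒<ᵇ≡true : ∀ {a b} → a < b → (a <ᵇ b) ≡ true
  <⇒<ᵇ≡true = Equivalence.to T-≡ ∘ <⇒<ᵇ

  ≤⇒<ᵇ≡false : ∀ {a b} → b ≤ a → (a <ᵇ b) ≡ false
  ≤⇒<ᵇ≡false {a} {b} b≤a = ¬-not (≤⇒≯ b≤a ∘ <ᵇ⇒< a b ∘ Equivalence.from T-≡)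

  between-empty : ∀ {lo hi} c → hi ≤ lo → b2n ((lo <ᵇ c) ∧ (c <ᵇ hi)) ≡ 0
  between-empty {lo} {hi} c hi≤lo with c <? hi
  ... | yes c<hi rewrite ≤⇒<ᵇ≡false (<⇒≤ (<-≤-trans c<hi hi≤lo)) = refl
  ... | no c≮hi  rewrite ≤⇒<ᵇ≡false (≮⇒≥ c≮hi) | ∧-zeroʳ (lo <ᵇ c) = refl

  countBetween-empty : ∀ {lo hi} w → hi ≤ lo → countBetween lo hi w ≡ 0
  countBetween-empty []      _     = refl
  countBetween-empty (c ∷ w) hi≤lo rewrite between-empty c hi≤lo = countBetween-empty w hi≤lo

  countAdj-skip : ∀ {a c} w → a ≤ c → countAdj a (c ∷ w) ≡ countAdj a w
  countAdj-skip []      _   = refl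
  countAdj-skip (d ∷ w) a≤c rewrite ≤⇒<ᵇ≡false a≤c = refl

  countAdj-top : ∀ {N w} → All (_≤ N) w → countAdj N w ≡ 0
  countAdj-top []           = refl
  countAdj-top (_ ∷ [])     = refl
  countAdj-top {N} {c ∷ d ∷ w} (_ ∷ ≤N@(d≤N ∷ _))
    rewrite countAdj-top ≤N | ≤⇒<ᵇ≡false d≤N | ∧-zeroʳ (c <ᵇ N) = refl

  hooks : Skeleton → ℕ
  hooks []             = 0
  hooks (letter a ∷ S) = hooks S
  hooks (slot ∷ S)     = hooks S
  hooks (hook b ∷ S)   = suc (hooks S)

  splits : Kind → ℕ
  splits fill   = 0
  splits extend = 0
  splits split  = 1

  module Statistics {x N : ℕ} (x<N : x < N) where

    -- What may follow a slot: each N comes right after a letter a < x. So each of the j slots gives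
    -- exactly one adjacent pair a, N enclosing x, which is why `res` grows by j.
    data Sparse : ℕ → List ℕ → Set where
      []     : Sparse 0 []
      letter : ∀ {j a w} → a < x → Sparse j w → Sparse j (a ∷ w)
      slot   : ∀ {j a w} → a < x → Sparse j w → Sparse (suc j) (a ∷ N ∷ w)

    block : Kind → List ℕ → List ℕ
    block fill   w = x ∷ w
    block extend w = x ∷ N ∷ w
    block split  w = N ∷ x ∷ N ∷ w

    -- Refine κ i j w w′: one letter N of w, with i letters N to its left and j to
    -- its right, is replaced according to κ.
    data Refine (κ : Kind) : ℕ → ℕ → List ℕ → List ℕ → Set where
      here  : ∀ {j w} → Sparse j w → Refine κ 0 j (N ∷ w) (block κ w)
      below : ∀ {i j a w w′} → a < x → Refine κ i j w w′ → Refine κ i j (a ∷ w) (a ∷ w′)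
      above : ∀ {i j b w w′} → b < x → Refine κ i j w w′ →
              Refine κ (suc i) j (N ∷ b ∷ w) (N ∷ b ∷ w′)

    word-sparse : ∀ {S} → Valid x S → Unslotted S → Sparse (slots S) (word N S)
    word-sparse []                                   _ = []
    word-sparse (letter a<x _ [])                    _ = letter a<x []
    word-sparse (letter a<x _ v@(letter _ _ _))      _ = letter a<x (word-sparse v letter)
    word-sparse (letter a<x _ (slot u _ v))          _ = slot a<x (word-sparse v u)
    word-sparse (letter a<x _ (hook b<x _ u _ v))    _ = slot a<x (slot b<x (word-sparse v u))

    word-place : ∀ κ S → word N (place κ x S) ≡ block κ (word N S)
    word-place fill   S = refl
    word-place extend S = refl
    word-place split  S = refl

    hooks-place : ∀ κ S → hooks (place κ x S) ≡ hooks S + splits κ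
    hooks-place fill   S = sym (+-identityʳ (hooks S))
    hooks-place extend S = sym (+-identityʳ (hooks S))
    hooks-place split  S = +-comm 1 (hooks S)

    -- Here i is the true number of slots to the left, and l the exponent of q recorded by the move.
    -- They differ by one exactly when a hook dissolves, and the equation books that difference as a
    -- change of `hooks`.
    Move-refine : ∀ {κ r l S S′} → Valid x S → Move x κ r l S S′ →
      ∃[ i ] (Refine κ i r (word N S) (word N S′) × i + hooks S′ ≡ l + hooks S + splits κ)
    Move-refine (slot u _ v) (at-slot κ {S}) = 0 ,
      subst (Refine κ 0 (slots S) (word N (slot ∷ S))) (sym (word-place κ S)) (here (word-sparse v u)) ,
      hooks-place κ S
    Move-refine (hook b<x _ u _ v) (at-hook κ {b} {S}) = 1 ,
      above b<x (subst (Refine κ 0 (slots S) (word N (slot ∷ S))) (sym (word-place κ S))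
        (here (word-sparse v u))) ,
      cong suc (hooks-place κ S)
    Move-refine (letter a<x _ v) (under-letter m) with i , ρ , eq ← Move-refine v m =
      i , below a<x ρ , eq
    Move-refine (slot letter _ (letter a<x _ v)) (under-slot (under-letter m))
      with i , ρ , eq ← Move-refine v m = suc i , above a<x ρ , cong suc eq
    Move-refine (hook b<x _ letter _ (letter a<x _ v))
      (under-hook {κ = κ} {l = l} (under-letter {S = S} {S′} m))
      with i , ρ , eq ← Move-refine v m = suc (suc i) , above b<x (above a<x ρ) ,
        cong (suc ∘ suc) (trans (+-suc i (hooks S′)) (trans (cong suc eq)
          (cong (_+ splits κ) (sym (+-suc l (hooks S))))))

    private
      x≤N : x ≤ N
      x≤N = <⇒≤ x<N

      <x⇒<N : ∀ {a} → a < x → a < N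
      <x⇒<N a<x = <-trans a<x x<N

    sparse≤ : ∀ {j w} → Sparse j w → All (_≤ N) w
    sparse≤ []             = []
    sparse≤ (letter a<x s) = <⇒≤ (<x⇒<N a<x) ∷ sparse≤ s
    sparse≤ (slot a<x s)   = <⇒≤ (<x⇒<N a<x) ∷ ≤-refl ∷ sparse≤ s

    refine≤ : ∀ {κ i j w w′} → Refine κ i j w w′ → All (_≤ N) w × All (_≤ N) w′
    refine≤ {fill}   (here s) = ≤-refl ∷ sparse≤ s , x≤N ∷ sparse≤ s
    refine≤ {extend} (here s) = ≤-refl ∷ sparse≤ s , x≤N ∷ ≤-refl ∷ sparse≤ s
    refine≤ {split}  (here s) = ≤-refl ∷ sparse≤ s , ≤-refl ∷ x≤N ∷ ≤-refl ∷ sparse≤ s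
    refine≤ (below a<x ρ) with w≤ , w′≤ ← refine≤ ρ =
      <⇒≤ (<x⇒<N a<x) ∷ w≤ , <⇒≤ (<x⇒<N a<x) ∷ w′≤
    refine≤ (above b<x ρ) with w≤ , w′≤ ← refine≤ ρ =
      ≤-refl ∷ <⇒≤ (<x⇒<N b<x) ∷ w≤ , ≤-refl ∷ <⇒≤ (<x⇒<N b<x) ∷ w′≤

    -- The letter `a` contributes the same amount δ before and after a refinement, so an induction
    -- can pass over it.
    Prefixed : (List ℕ → ℕ) → (List ℕ → ℕ) → ℕ → List ℕ → List ℕ → Set
    Prefixed f g a w w′ = ∃[ δ ] (f (a ∷ w) ≡ δ + g w × f (a ∷ w′) ≡ δ + g w′)

    des-prefix : ∀ {κ i j w w′ a} → a < x → Refine κ i j w w′ → Prefixed des des a w w′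
    des-prefix {fill}   a<x (here _)
      rewrite ≤⇒<ᵇ≡false (<⇒≤ a<x) | ≤⇒<ᵇ≡false (<⇒≤ (<x⇒<N a<x)) = 0 , refl , refl
    des-prefix {extend} a<x (here _)
      rewrite ≤⇒<ᵇ≡false (<⇒≤ a<x) | ≤⇒<ᵇ≡false (<⇒≤ (<x⇒<N a<x)) = 0 , refl , refl
    des-prefix {split}  a<x (here _) = _ , refl , refl
    des-prefix a<x (below _ _) = _ , refl , refl
    des-prefix {a = a} a<x (above _ _) = b2n (N <ᵇ a) , refl , refl

    des-sparse : ∀ {j w} → Sparse j w → des (x ∷ w) ≡ des (N ∷ w)
    des-sparse []             = refl
    des-sparse (letter a<x _) rewrite <⇒<ᵇ≡true a<x | <⇒<ᵇ≡true (<x⇒<N a<x) = refl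
    des-sparse (slot a<x _)   rewrite <⇒<ᵇ≡true a<x | <⇒<ᵇ≡true (<x⇒<N a<x) = refl

    des-refine : ∀ {κ i j w w′} → Refine κ i j w w′ → des w′ ≡ splits κ + des w
    des-refine {fill}   (here s) = des-sparse s
    des-refine {extend} (here s) rewrite ≤⇒<ᵇ≡false x≤N = refl
    des-refine {split}  (here s) rewrite ≤⇒<ᵇ≡false x≤N | <⇒<ᵇ≡true x<N = refl
    des-refine {κ} (below a<x ρ) with δ , eq , eq′ ← des-prefix a<x ρ =
      trans eq′ (trans (cong (δ +_) (des-refine ρ))
        (trans (x∙yz≈y∙xz δ (splits κ) _) (cong (splits κ +_) (sym eq))))
    des-refine {κ} (above {b = b} {w} b<x ρ) with δ , eq , eq′ ← des-prefix b<x ρ =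
      trans (cong (b2n (b <ᵇ N) +_) (trans eq′ (trans (cong (δ +_) (des-refine ρ))
        (trans (x∙yz≈y∙xz δ (splits κ) _) (cong (splits κ +_) (sym eq))))))
        (x∙yz≈y∙xz (b2n (b <ᵇ N)) (splits κ) (des (b ∷ w)))

    between-N : ∀ lo {hi} → hi ≤ N → b2n ((lo <ᵇ N) ∧ (N <ᵇ hi)) ≡ 0
    between-N lo hi≤N rewrite ≤⇒<ᵇ≡false hi≤N | ∧-zeroʳ (lo <ᵇ N) = refl

    countBetween-refine : ∀ {κ i j w w′} lo {hi} → hi ≤ N → Refine κ i j w w′ →
      countBetween lo hi w′ ≡ b2n ((lo <ᵇ x) ∧ (x <ᵇ hi)) + countBetween lo hi w
    countBetween-refine {fill}   lo hi≤N (here s) rewrite between-N lo hi≤N = refl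
    countBetween-refine {extend} lo hi≤N (here s) rewrite between-N lo hi≤N = refl
    countBetween-refine {split}  lo hi≤N (here s) rewrite between-N lo hi≤N = refl
    countBetween-refine lo {hi} hi≤N (below {a = a} a<x ρ) rewrite countBetween-refine lo hi≤N ρ =
      x∙yz≈y∙xz (b2n ((lo <ᵇ a) ∧ (a <ᵇ hi))) (b2n ((lo <ᵇ x) ∧ (x <ᵇ hi))) _
    countBetween-refine lo {hi} hi≤N (above {b = b} b<x ρ)
      rewrite between-N lo hi≤N | countBetween-refine lo hi≤N ρ =
      x∙yz≈y∙xz (b2n ((lo <ᵇ b) ∧ (b <ᵇ hi))) (b2n ((lo <ᵇ x) ∧ (x <ᵇ hi))) _

    countBetween-sparse : ∀ {j w} lo → Sparse j w → countBetween lo x w ≡ countBetween lo N w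
    countBetween-sparse lo [] = refl
    countBetween-sparse lo (letter a<x s)
      rewrite <⇒<ᵇ≡true a<x | <⇒<ᵇ≡true (<x⇒<N a<x) | countBetween-sparse lo s = refl
    countBetween-sparse lo (slot a<x s)
      rewrite <⇒<ᵇ≡true a<x | <⇒<ᵇ≡true (<x⇒<N a<x) | between-N lo x≤N | between-N lo (≤-refl {N})
            | countBetween-sparse lo s = refl

    countBetween-x-N : ∀ {j w} → Sparse j w → countBetween x N w ≡ 0
    countBetween-x-N [] = refl
    countBetween-x-N (letter a<x s) rewrite ≤⇒<ᵇ≡false (<⇒≤ a<x) = countBetween-x-N s
    countBetween-x-N (slot a<x s)   rewrite ≤⇒<ᵇ≡false (<⇒≤ a<x) | between-N x (≤-refl {N}) =
      countBetween-x-N s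

    les-prefix : ∀ {κ i j w w′ a} → a < x → Refine κ i j w w′ → Prefixed les les a w w′
    les-prefix {fill} {a = a} a<x (here {w = w} s)
      rewrite countBetween-empty w (<⇒≤ a<x)
            | countBetween-empty w (<⇒≤ (<x⇒<N a<x)) = 0 , refl , refl
    les-prefix {extend} {a = a} a<x (here {w = w} s)
      rewrite countBetween-empty (N ∷ w) (<⇒≤ a<x)
            | countBetween-empty w (<⇒≤ (<x⇒<N a<x)) = 0 , refl , refl
    les-prefix {split} {a = a} a<x (here {w = w} s)
      rewrite countBetween-empty (x ∷ N ∷ w) (<⇒≤ (<x⇒<N a<x))
            | countBetween-empty w (<⇒≤ (<x⇒<N a<x)) = 0 , refl , refl
    les-prefix {a = a} a<x (below {a = b} _ ρ)
      rewrite countBetween-refine b (<⇒≤ (<x⇒<N a<x)) ρ | ≤⇒<ᵇ≡false (<⇒≤ a<x) | ∧-zeroʳ (b <ᵇ x) =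
      _ , refl , refl
    les-prefix {a = a} a<x (above {b = b} {w} {w′} _ ρ)
      rewrite countBetween-empty (b ∷ w) (<⇒≤ (<x⇒<N a<x))
            | countBetween-empty (b ∷ w′) (<⇒≤ (<x⇒<N a<x)) =
      0 , refl , refl

    les-sparse : ∀ {j w} → Sparse j w → les (x ∷ w) ≡ les (N ∷ w)
    les-sparse [] = refl
    les-sparse (letter {a = a} _ s) rewrite countBetween-sparse a s = refl
    les-sparse (slot {a = a} _ s)
      rewrite between-N a x≤N | between-N a (≤-refl {N}) | countBetween-sparse a s = refl

    -- Each N on the left is followed by some b < x, and x now lies between the two. The new descent
    -- N, x of a split encloses nothing, because no other letter lies strictly between x and N.
    les-refine : ∀ {κ i j w w′} → Refine κ i j w w′ → les w′ ≡ i + les w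
    les-refine {fill}   (here s) = les-sparse s
    les-refine {extend} (here {w = w} s) rewrite countBetween-empty w x≤N = refl
    les-refine {split}  (here {w = w} s)
      rewrite between-N x (≤-refl {N}) | countBetween-x-N s | countBetween-empty w x≤N = refl
    les-refine {i = i} (below a<x ρ) with δ , eq , eq′ ← les-prefix a<x ρ =
      trans eq′ (trans (cong (δ +_) (les-refine ρ)) (trans (x∙yz≈y∙xz δ i _) (cong (i +_) (sym eq))))
    les-refine {i = suc i} (above {b = b} {w} b<x ρ)
      with δ , eq , eq′ ← les-prefix b<x ρ
      rewrite countBetween-refine b (≤-refl {N}) ρ | <⇒<ᵇ≡true b<x | <⇒<ᵇ≡true x<N =
      cong suc (trans (cong (countBetween b N w +_) (trans eq′ (trans (cong (δ +_) (les-refine ρ))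
        (trans (x∙yz≈y∙xz δ i _) (cong (i +_) (sym eq)))))) (x∙yz≈y∙xz (countBetween b N w) i _))

    countAdj-prefix : ∀ {κ i j w w′ a c} → a < x → Refine κ i j w w′ →
                      Prefixed (countAdj a) (countAdj a) c w w′
    countAdj-prefix {fill}   a<x (here _)
      rewrite <⇒<ᵇ≡true a<x | <⇒<ᵇ≡true (<x⇒<N a<x) = _ , refl , refl
    countAdj-prefix {extend} a<x (here _)
      rewrite <⇒<ᵇ≡true a<x | <⇒<ᵇ≡true (<x⇒<N a<x) = _ , refl , refl
    countAdj-prefix {split}  a<x (here _) = _ , refl , refl
    countAdj-prefix a<x (below _ _) = _ , refl , refl
    countAdj-prefix {a = a} {c} a<x (above _ _) = b2n ((c <ᵇ a) ∧ (a <ᵇ N)) , refl , refl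

    countAdj-refine : ∀ {κ i j w w′ a} → a < x → Refine κ i j w w′ → countAdj a w′ ≡ countAdj a w
    countAdj-refine {κ} {a = a} a<x (here {w = w} s) = trans (block-skip κ) (sym (skip-N w))
      where
      skip-N : ∀ w → countAdj a (N ∷ w) ≡ countAdj a w
      skip-N w = countAdj-skip w (<⇒≤ (<x⇒<N a<x))
      block-skip : ∀ κ → countAdj a (block κ w) ≡ countAdj a w
      block-skip fill   = countAdj-skip w (<⇒≤ a<x)
      block-skip extend = trans (countAdj-skip (N ∷ w) (<⇒≤ a<x)) (skip-N w)
      block-skip split  = trans (skip-N (x ∷ N ∷ w)) (block-skip extend)
    countAdj-refine a<x (below _ ρ) with δ , eq , eq′ ← countAdj-prefix a<x ρ =
      trans eq′ (trans (cong (δ +_) (countAdj-refine a<x ρ)) (sym eq))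
    countAdj-refine a<x (above {b = b} {w} {w′} _ ρ) with δ , eq , eq′ ← countAdj-prefix a<x ρ =
      trans (countAdj-skip (b ∷ w′) (<⇒≤ (<x⇒<N a<x))) (trans eq′
        (trans (cong (δ +_) (countAdj-refine a<x ρ))
          (trans (sym eq) (sym (countAdj-skip (b ∷ w) (<⇒≤ (<x⇒<N a<x)))))))

    countAdj-sparse : ∀ {j w} → Sparse j w → countAdj x w ≡ j
    countAdj-sparse []             = refl
    countAdj-sparse (letter _ [])  = refl
    countAdj-sparse (letter {a = a} _ s@(letter b<x _))
      rewrite countAdj-sparse s | ≤⇒<ᵇ≡false (<⇒≤ b<x) | ∧-zeroʳ (a <ᵇ x) = refl
    countAdj-sparse (letter {a = a} _ s@(slot b<x _))
      rewrite countAdj-sparse s | ≤⇒<ᵇ≡false (<⇒≤ b<x) | ∧-zeroʳ (a <ᵇ x) = refl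
    countAdj-sparse (slot {w = w} a<x s)
      rewrite <⇒<ᵇ≡true a<x | <⇒<ᵇ≡true x<N | countAdj-skip w x≤N = cong suc (countAdj-sparse s)

    -- No ascent encloses a top letter N, and a letter a < x cannot tell x from N. Only the pairs
    -- enclosing x itself are new.
    res-refine : ∀ {κ i j w w′} → Refine κ i j w w′ → res w′ ≡ j + res w
    res-refine {fill} (here s) rewrite countAdj-top (sparse≤ s) | countAdj-sparse s = refl
    res-refine {extend} (here {w = w} s)
      rewrite countAdj-top (sparse≤ s) | countAdj-skip w x≤N | countAdj-sparse s = refl
    res-refine {split} (here {w = w} s)
      rewrite countAdj-top (x≤N ∷ ≤-refl ∷ sparse≤ s) | countAdj-top (sparse≤ s)
            | countAdj-skip w x≤N | countAdj-sparse s = refl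
    res-refine {j = j} (below {a = a} {w} a<x ρ)
      rewrite countAdj-refine a<x ρ | res-refine ρ = x∙yz≈y∙xz (countAdj a w) j (res w)
    res-refine {j = j} (above {b = b} {w} b<x ρ)
      rewrite countAdj-top (<⇒≤ (<x⇒<N b<x) ∷ proj₁ (refine≤ ρ))
            | countAdj-top (<⇒≤ (<x⇒<N b<x) ∷ proj₂ (refine≤ ρ))
            | countAdj-refine b<x ρ | res-refine ρ = x∙yz≈y∙xz (countAdj b w) j (res w)

  -- André permutations as the fillings of a single slot.

  allB⁻ : ∀ {A : Set} (P : A → Bool) xs → allB P xs ≡ true → ∀ {x} → x ∈ xs → P x ≡ true
  allB⁻ P (x ∷ xs) eq (here refl) = ∧-conicalˡ (P x) _ eq
  allB⁻ P (x ∷ xs) eq (there x∈)  = allB⁻ P xs (∧-conicalʳ (P x) _ eq) x∈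

  allB⁺ : ∀ {A : Set} (P : A → Bool) xs → (∀ {x} → x ∈ xs → P x ≡ true) → allB P xs ≡ true
  allB⁺ P []       _  = refl
  allB⁺ P (x ∷ xs) ok = cong₂ _∧_ (ok (here refl)) (allB⁺ P xs (ok ∘ there))

  elem⁻ : ∀ a w → elem a w ≡ true → a ∈ w
  elem⁻ a (b ∷ w) eq with a ≡ᵇ b in a≡ᵇb
  ... | true  = here (≡ᵇ⇒≡ a b (subst T (sym a≡ᵇb) tt))
  ... | false = there (elem⁻ a w eq)

  elem⁺ : ∀ {a w} → a ∈ w → elem a w ≡ true
  elem⁺ {a} {b ∷ w} a∈ with a ≡ᵇ b in a≡ᵇb
  elem⁺ {a} {b ∷ w} a∈           | true  = refl
  elem⁺ {a} {b ∷ w} (here refl)  | false with () ← subst T a≡ᵇb (≡⇒≡ᵇ a a refl)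
  elem⁺ {a} {b ∷ w} (there a∈)   | false = elem⁺ a∈

  ∈-range⁺ : ∀ {i n} → 0 < i → i ≤ n → i ∈ range n
  ∈-range⁺ {suc i} _ i<n = ∈-map⁺ suc (∈-upTo⁺ i<n)

  ∈-range⁻ : ∀ {i n} → i ∈ range n → 0 < i × i ≤ n
  ∈-range⁻ i∈ with _ , j∈ , refl ← ∈-map⁻ suc i∈ = s≤s z≤n , ∈-upTo⁻ j∈

  range-unique : ∀ n → Unique (range n)
  range-unique n = Uniqueₚ.map⁺ suc-injective (Uniqueₚ.upTo⁺ n)

  length-range : ∀ n → length (range n) ≡ n
  length-range n = trans (length-map suc (upTo n)) (length-upTo n)

  range-suc : ∀ n → suc n ∷ range n ↭ range (suc n)
  range-suc n = ↭-trans (∷↭∷ʳ (suc n) (range n)) (↭-reflexive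
    (trans (sym (map-++ suc (upTo n) (n ∷ []))) (cong (map suc) (upTo-∷ʳ n))))

  Unique-resp-↭ : ∀ {A : Set} {xs ys : List A} → xs ↭ ys → Unique xs → Unique ys
  Unique-resp-↭ {A} xs↭ys = ↭ₛ.Unique-resp-↭ (setoid A) (↭⇒↭ₛ xs↭ys)

  -- Pigeonhole, by removing the head of `xs` from `ys`. It turns a word of length n in which each
  -- of 1, ..., n occurs into a rearrangement of 1, ..., n.
  unique∧⊆∧length⇒↭ : ∀ {A : Set} {xs ys : List A} → Unique xs → (∀ {x} → x ∈ xs → x ∈ ys) →
    length ys ≤ length xs → xs ↭ ys
  unique∧⊆∧length⇒↭ {xs = []}     {[]} _ _ _ = ↭-refl
  unique∧⊆∧length⇒↭ {xs = x ∷ xs} u@(_ ∷ u′) ⊆ ≤ with ∈-∃++ (⊆ (here refl))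
  ... | as , bs , refl = ↭-trans
    (↭-prep x (unique∧⊆∧length⇒↭ u′ ⊆′
      (s≤s⁻¹ (≤-trans (≤-reflexive (sym (↭-length (shift x as bs)))) ≤))))
    (↭-sym (shift x as bs))
    where
    ⊆′ : ∀ {y} → y ∈ xs → y ∈ as ++ bs
    ⊆′ y∈ with ∈-resp-↭ (shift x as bs) (⊆ (there y∈))
    ... | here refl = contradiction y∈ (head∉ u)
    ... | there y∈′ = y∈′

  words-unique : ∀ k n → Unique (words k n)
  words-unique zero    n = [] ∷ []
  words-unique (suc k) n = concatMap-unique (λ w → map (_∷ w) (range n)) id (drop 1) (words k n)
    (subst Unique (sym (map-id (words k n))) (words-unique k n))
    (λ _ → Uniqueₚ.map⁺ ∷-injectiveˡ (range-unique n))
    (λ _ w∈ → cong (drop 1) (proj₂ (proj₂ (∈-map⁻ _ w∈))))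

  ∈-words⁻ : ∀ k {n w} → w ∈ words k n → length w ≡ k × All (_∈ range n) w
  ∈-words⁻ zero (here refl) = refl , []
  ∈-words⁻ (suc k) {n} w∈
    with v , v∈ , w∈′ ← find (∈-concatMap⁻ (λ v → map (_∷ v) (range n)) {xs = words k n} w∈)
    with a , a∈ , refl ← ∈-map⁻ (_∷ v) w∈′
    with len , all∈ ← ∈-words⁻ k v∈ = cong suc len , a∈ ∷ all∈

  ∈-words⁺ : ∀ {n w} → All (_∈ range n) w → w ∈ words (length w) n
  ∈-words⁺ [] = here refl
  ∈-words⁺ {n} {a ∷ w} (a∈ ∷ w∈) =
    ∈-concatMap⁺ (λ v → map (_∷ v) (range n)) (lose (∈-words⁺ w∈) (∈-map⁺ (_∷ w) a∈))

  ∈-perms⁻ : ∀ {n σ} → σ ∈ perms n → σ ↭ range n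
  ∈-perms⁻ {n} {σ} σ∈ with w∈ , isP ← ∈-filter⁻ (λ w → isPerm n w ≟ᵇ true) {xs = words n n} σ∈ =
    ↭-sym (unique∧⊆∧length⇒↭ (range-unique n)
      (λ {i} i∈ → elem⁻ i σ (allB⁻ (λ i → elem i σ) (range n) isP i∈))
      (≤-reflexive (trans (proj₁ (∈-words⁻ n w∈)) (sym (length-range n)))))

  ∈-perms⁺ : ∀ {n σ} → σ ↭ range n → σ ∈ perms n
  ∈-perms⁺ {n} {σ} σ↭ = ∈-filter⁺ (λ w → isPerm n w ≟ᵇ true)
    (subst (λ k → σ ∈ words k n) (trans (↭-length σ↭) (length-range n))
      (∈-words⁺ (All.tabulate (∈-resp-↭ σ↭))))
    (allB⁺ (λ i → elem i σ) (range n) (elem⁺ ∘ ∈-resp-↭ (↭-sym σ↭)))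

  hasDDpadded⁻ : ∀ a w → hasDDpadded (a ∷ (w ++ 0 ∷ [])) ≡ false → Smooth (a ∷ w)
  hasDDpadded⁻ a [] _ = (λ _ → z≤n) , tt
  hasDDpadded⁻ a (b ∷ w) eq = rises w eq , hasDDpadded⁻ b w (tail w eq)
    where
    rises′ : ∀ c → (b <ᵇ a) ∧ (c <ᵇ b) ≡ false → b < a → b ≤ c
    rises′ c eq b<a with b ≤? c
    ... | yes b≤c = b≤c
    ... | no b≰c rewrite <⇒<ᵇ≡true b<a | <⇒<ᵇ≡true (≰⇒> b≰c) with () ← eq
    rises : ∀ w → hasDDpadded (a ∷ b ∷ (w ++ 0 ∷ [])) ≡ false → b < a → b ≤ first w
    rises []      eq = rises′ 0 (∨-conicalˡ _ _ eq)
    rises (c ∷ w) eq = rises′ c (∨-conicalˡ _ _ eq)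
    tail : ∀ w → hasDDpadded (a ∷ b ∷ (w ++ 0 ∷ [])) ≡ false → hasDDpadded (b ∷ (w ++ 0 ∷ [])) ≡ false
    tail []      eq = refl
    tail (c ∷ w) eq = ∨-conicalʳ ((b <ᵇ a) ∧ (c <ᵇ b)) _ eq

  hasDDpadded⁺ : ∀ a w → Smooth (a ∷ w) → hasDDpadded (a ∷ (w ++ 0 ∷ [])) ≡ false
  hasDDpadded⁺ a [] _ = refl
  hasDDpadded⁺ a (b ∷ w) (ok , smooth) = glue w ok (hasDDpadded⁺ b w smooth)
    where
    glue′ : ∀ c → (b < a → b ≤ c) → (b <ᵇ a) ∧ (c <ᵇ b) ≡ false
    glue′ c ok with b <? a
    ... | yes b<a rewrite ≤⇒<ᵇ≡false (ok b<a) | <⇒<ᵇ≡true b<a = refl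
    ... | no b≮a  rewrite ≤⇒<ᵇ≡false (≮⇒≥ b≮a) = refl
    glue : ∀ w → (b < a → b ≤ first w) → hasDDpadded (b ∷ (w ++ 0 ∷ [])) ≡ false →
           hasDDpadded (a ∷ b ∷ (w ++ 0 ∷ [])) ≡ false
    glue []      ok eq = cong₂ _∨_ (glue′ 0 ok) eq
    glue (c ∷ w) ok eq = cong₂ _∨_ (glue′ c ok) eq

  -- A final descent to a positive letter would continue with the descent to the closing 0.
  Smooth⇒endsWithAscent : ∀ w → Smooth w → Unique w → All (0 <_) w → endsWithAscent w ≡ true
  Smooth⇒endsWithAscent [] _ _ _ = refl
  Smooth⇒endsWithAscent (a ∷ []) _ _ (0<a ∷ _) = <⇒<ᵇ≡true 0<a
  Smooth⇒endsWithAscent (a ∷ b ∷ []) (ok , _) ((a≢b ∷ _) ∷ _) (_ ∷ 0<b ∷ _) =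
    <⇒<ᵇ≡true (≤∧≢⇒< (≮⇒≥ (λ b<a → contradiction 0<b (≤⇒≯ (ok b<a)))) a≢b)
  Smooth⇒endsWithAscent (a ∷ b ∷ c ∷ w) (_ , smooth) (_ ∷ u) (_ ∷ 0<) =
    Smooth⇒endsWithAscent (b ∷ c ∷ w) smooth u 0<

  subword-0 : ∀ {w} → All (0 <_) w → subword 0 w ≡ []
  subword-0 []                       = refl
  subword-0 {a ∷ w} (0<a ∷ 0<w) = trans (subword-> w 0<a) (subword-0 0<w)

  ↭range⇒positive : ∀ {n σ} → σ ↭ range n → All (0 <_) σ
  ↭range⇒positive σ↭ = All.tabulate (proj₁ ∘ ∈-range⁻ ∘ ∈-resp-↭ σ↭)

  isAndre⁻ : ∀ {n σ} → σ ↭ range n → isAndre n σ ≡ true → ∀ z → z ≤ n → Smooth (subword z σ)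
  isAndre⁻ {σ = σ} σ↭ _ zero _ = subst Smooth (sym (subword-0 (↭range⇒positive σ↭))) tt
  isAndre⁻ {n} {σ} σ↭ isA (suc z) z≤ = proj₂ (hasDDpadded⁻ 0 (subword (suc z) σ) (not-true
    (∧-conicalˡ _ _ (allB⁻ _ (range n) isA (∈-range⁺ (s≤s z≤n) z≤)))))
    where
    not-true : ∀ {b} → not b ≡ true → b ≡ false
    not-true {false} _ = refl

  isAndre⁺ : ∀ {n σ} → σ ↭ range n → (∀ z → z ≤ n → Smooth (subword z σ)) → isAndre n σ ≡ true
  isAndre⁺ {n} {σ} σ↭ smooth = allB⁺ _ (range n) (λ {z} z∈ → cong₂ (λ a b → not a ∧ b)
    (hasDDpadded⁺ 0 (subword z σ) ((λ ()) , smooth z (proj₂ (∈-range⁻ z∈))))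
    (Smooth⇒endsWithAscent (subword z σ) (smooth z (proj₂ (∈-range⁻ z∈)))
      (Uniqueₚ.filter⁺ _ (Unique-resp-↭ (↭-sym σ↭) (range-unique n)))
      (All.tabulate (λ a∈ → All.lookup (↭range⇒positive σ↭) (proj₁ (∈-filter⁻ _ {xs = σ} a∈))))))

  ∈-andre⁻ : ∀ {n σ} → σ ∈ andre n → σ ↭ range n × (∀ z → z ≤ n → Smooth (subword z σ))
  ∈-andre⁻ {n} {σ} σ∈ with σ∈p , isA ← ∈-filter⁻ (λ σ → isAndre n σ ≟ᵇ true) {xs = perms n} σ∈ =
    ∈-perms⁻ σ∈p , isAndre⁻ (∈-perms⁻ σ∈p) isA

  ∈-andre⁺ : ∀ {n σ} → σ ↭ range n → (∀ z → z ≤ n → Smooth (subword z σ)) → σ ∈ andre n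
  ∈-andre⁺ {n} σ↭ smooth = ∈-filter⁺ (λ σ → isAndre n σ ≟ᵇ true) (∈-perms⁺ σ↭) (isAndre⁺ σ↭ smooth)

  andre-unique : ∀ n → Unique (andre n)
  andre-unique n = Uniqueₚ.filter⁺ _ (Uniqueₚ.filter⁺ _ (words-unique n n))

  fillings-↭ : ∀ k {y S σ} → σ ∈ fillings k (suc y) S → letters S ↭ range y → σ ↭ range (k + y)
  fillings-↭ zero {y} {S} σ∈ S↭ with refl ← proj₂ (∈-fillings-zero {suc y} 0 S σ∈) = S↭
  fillings-↭ (suc k) {y} {S} {σ} σ∈ S↭ with _ , _ , _ , S′ , m , σ∈′ ← ∈-fillings⁻ k {S = S} σ∈ =
    subst (λ n → σ ↭ range n) (+-suc k y) (fillings-↭ k {S = S′} σ∈′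
      (↭-trans (Insert⇒↭ (Move-insert m)) (↭-trans (↭-prep (suc y) S↭) (range-suc y))))

  unfilled : Skeleton
  unfilled = slot ∷ []

  unfilled-valid : Valid 1 unfilled
  unfilled-valid = slot [] z≤n []

  andre↭fillings : ∀ n → andre (suc n) ↭ fillings (suc n) 1 unfilled
  andre↭fillings n = ∼bag⇒↭ (unique∧set⇒bag (andre-unique (suc n))
    (fillings-unique (suc n) (s≤s z≤n) ≤-refl unfilled-valid) (mk⇔ to from))
    where
    n+0 : suc n + 0 ≡ suc n
    n+0 = +-identityʳ (suc n)
    to : ∀ {σ} → σ ∈ andre (suc n) → σ ∈ fillings (suc n) 1 unfilled
    to {σ} σ∈ with σ↭ , smooth ← ∈-andre⁻ σ∈ =
      subst (λ S → σ ∈ fillings (suc n) 1 S) (skeleton-unfilled σ (↭range⇒positive σ↭) σ↭)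
        (∈-fillings⁺ (suc n) (Unique-resp-↭ (↭-sym σ↭) (range-unique (suc n)))
          (All.tabulate (λ a∈ → ≤-trans (proj₂ (∈-range⁻ (∈-resp-↭ σ↭ a∈))) (≤-reflexive (sym n+0))))
          (λ z 0<z z≤ → ∈-resp-↭ (↭-sym σ↭) (∈-range⁺ 0<z (≤-trans z≤ (≤-reflexive n+0))))
          (λ z z≤ → smooth z (≤-trans z≤ (≤-reflexive n+0))))
      where
      skeleton-unfilled : ∀ σ → All (0 <_) σ → σ ↭ range (suc n) → skeleton 0 σ ≡ unfilled
      skeleton-unfilled []      _  σ↭ with () ← ↭-length σ↭
      skeleton-unfilled (a ∷ σ) 0< _  = skeleton-0 a σ 0<
    from : ∀ {σ} → σ ∈ fillings (suc n) 1 unfilled → σ ∈ andre (suc n)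
    from {σ} σ∈ = ∈-andre⁺ (subst (λ m → σ ↭ range m) n+0 (fillings-↭ (suc n) {S = unfilled} σ∈ ↭-refl))
      (λ z z≤ → fillings-smooth {suc n + 1} (suc n) {S = unfilled} ≤-refl unfilled-valid σ∈
        (λ { zero _ → tt }) z (≤-trans z≤ (≤-reflexive (sym n+0))))

open Skeletons

-- slots (place κ x S) and slots S determine each other through κ; both sides
-- are shifted by one so that filling needs no subtraction.
grow : Kind → ℕ → ℕ
grow fill   m = m
grow extend m = suc m
grow split  m = suc (suc m)

grow-suc : ∀ κ m → grow κ (suc m) ≡ suc (grow κ m)
grow-suc fill   m = ≡.refl
grow-suc extend m = ≡.refl
grow-suc split  m = ≡.refl

Move-slots : ∀ {x κ r l S S′} → Move x κ r l S S′ → suc (slots S′) ≡ grow κ (slots S)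
Move-slots (at-slot fill)   = ≡.refl
Move-slots (at-slot extend) = ≡.refl
Move-slots (at-slot split)  = ≡.refl
Move-slots (at-hook fill)   = ≡.refl
Move-slots (at-hook extend) = ≡.refl
Move-slots (at-hook split)  = ≡.refl
Move-slots (under-letter m) = Move-slots m
Move-slots {κ = κ} (under-slot m) = ≡.trans (≡.cong suc (Move-slots m)) (≡.sym (grow-suc κ _))
Move-slots {κ = κ} (under-hook {S = S} m) = ≡.trans (≡.cong (suc ∘ suc) (Move-slots m))
  (≡.sym (≡.trans (grow-suc κ (suc (slots S))) (≡.cong suc (grow-suc κ (slots S)))))

-- Finite sums in a commutative semiring.

module Sums {c ℓ : Level} (R : CommutativeSemiring c ℓ) where
  open CommutativeSemiring R renaming (Carrier to C)
  open import Algebra.Solver.Ring.NaturalCoefficients.Default R using (solve; _:=_; _:+_; _:*_)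
  open import Relation.Binary.Reasoning.Setoid setoid

  sumTo-cong : ∀ n {f g : ℕ → C} → (∀ i → i < n → f i ≈ g i) → sumTo R n f ≈ sumTo R n g
  sumTo-cong zero    f≈g = refl
  sumTo-cong (suc n) f≈g =
    +-cong (sumTo-cong n (λ i i<n → f≈g i (ℕₚ.m<n⇒m<1+n i<n))) (f≈g n ℕₚ.≤-refl)

  sumTo-*ˡ : ∀ a n (f : ℕ → C) → sumTo R n (λ i → a * f i) ≈ a * sumTo R n f
  sumTo-*ˡ a zero    f = sym (zeroʳ a)
  sumTo-*ˡ a (suc n) f = trans (+-congʳ (sumTo-*ˡ a n f)) (sym (distribˡ a _ _))

  sumTo-zero : ∀ n {f : ℕ → C} → (∀ i → i < n → f i ≈ 0#) → sumTo R n f ≈ 0#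
  sumTo-zero zero    f≈0 = refl
  sumTo-zero (suc n) f≈0 = trans (+-cong (sumTo-zero n (λ i i<n → f≈0 i (ℕₚ.m<n⇒m<1+n i<n)))
    (f≈0 n ℕₚ.≤-refl)) (+-identityˡ 0#)

  sumTo-+ : ∀ n (f g : ℕ → C) → sumTo R n (λ i → f i + g i) ≈ sumTo R n f + sumTo R n g
  sumTo-+ zero    f g = sym (+-identityˡ 0#)
  sumTo-+ (suc n) f g = begin
    sumTo R n (λ i → f i + g i) + (f n + g n)     ≈⟨ +-congʳ (sumTo-+ n f g) ⟩
    (sumTo R n f + sumTo R n g) + (f n + g n)
      ≈⟨ solve 4 (λ a b c d → (a :+ b) :+ (c :+ d) := (a :+ c) :+ (b :+ d)) refl _ _ _ _ ⟩
    (sumTo R n f + f n) + (sumTo R n g + g n)     ∎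

  sumTo-swap : ∀ m n (f : ℕ → ℕ → C) →
    sumTo R m (λ i → sumTo R n (f i)) ≈ sumTo R n (λ j → sumTo R m (λ i → f i j))
  sumTo-swap zero    n f = sym (sumTo-zero n (λ _ _ → refl))
  sumTo-swap (suc m) n f = trans (+-congʳ (sumTo-swap m n f)) (sym (sumTo-+ n _ (f m)))

  sumTo-head : ∀ n (f : ℕ → C) → sumTo R (suc n) f ≈ f 0 + sumTo R n (λ i → f (suc i))
  sumTo-head zero    f = +-comm _ _
  sumTo-head (suc n) f = trans (+-congʳ (sumTo-head n f)) (+-assoc _ _ _)

  module _ {A : Set} where

    sumList-cong : ∀ (xs : List A) {f g : A → C} → (∀ {x} → x ∈ xs → f x ≈ g x) →
                   sumList R f xs ≈ sumList R g xs
    sumList-cong []       f≈g = refl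
    sumList-cong (x ∷ xs) f≈g = +-cong (f≈g (here ≡.refl)) (sumList-cong xs (f≈g ∘ there))

    sumList-++ : ∀ (f : A → C) xs ys →
                 sumList R f (xs ++ ys) ≈ sumList R f xs + sumList R f ys
    sumList-++ f []       ys = sym (+-identityˡ _)
    sumList-++ f (x ∷ xs) ys = trans (+-congˡ (sumList-++ f xs ys)) (sym (+-assoc _ _ _))

    sumList-*ˡ : ∀ a (f : A → C) xs → sumList R (λ x → a * f x) xs ≈ a * sumList R f xs
    sumList-*ˡ a f []       = sym (zeroʳ a)
    sumList-*ˡ a f (x ∷ xs) = trans (+-congˡ (sumList-*ˡ a f xs)) (sym (distribˡ a _ _))

  sumList-map : ∀ {A B : Set} (f : B → C) (h : A → B) xs →
                sumList R f (map h xs) ≈ sumList R (f ∘ h) xs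
  sumList-map f h []       = refl
  sumList-map f h (x ∷ xs) = +-congˡ (sumList-map f h xs)

  sumList-concatMap : ∀ {A B : Set} (f : B → C) (h : A → List B) xs →
    sumList R f (concatMap h xs) ≈ sumList R (λ x → sumList R f (h x)) xs
  sumList-concatMap f h []       = refl
  sumList-concatMap f h (x ∷ xs) =
    trans (sumList-++ f (h x) _) (+-congˡ (sumList-concatMap f h xs))

-- Identities for [m] and binom(m,2), and the eigenvector.

module Gaussian {c ℓ : Level} (R : CommutativeSemiring c ℓ)
                (p q : CommutativeSemiring.Carrier R) where
  open CommutativeSemiring R renaming (Carrier to C)
  open import Algebra.Solver.Ring.NaturalCoefficients.Default R using (solve; _:=_; _:+_; _:*_)
  open import Relation.Binary.Reasoning.Setoid setoid
  open Sums R

  ⟦_⟧ : ℕ → C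
  ⟦ m ⟧ = qint R p q m

  pairs : ℕ → C
  pairs m = qbinom R p q m 2

  ⟦suc⟧ : ∀ m → ⟦ suc m ⟧ ≈ pw R p m + q * ⟦ m ⟧
  ⟦suc⟧ m = begin
    sumTo R m (λ i → pw R p i * pw R q (m ∸ i)) + pw R p m * pw R q (m ∸ m)
      ≈⟨ +-cong (sumTo-cong m shift) (*-congˡ (reflexive (≡.cong (pw R q) (ℕₚ.n∸n≡0 m)))) ⟩
    sumTo R m (λ i → q * (pw R p i * pw R q (m ∸ suc i))) + pw R p m * 1#
      ≈⟨ +-cong (sumTo-*ˡ q m _) (*-identityʳ _) ⟩
    q * ⟦ m ⟧ + pw R p m
      ≈⟨ +-comm _ _ ⟩
    pw R p m + q * ⟦ m ⟧ ∎
    where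
    shift : ∀ i → i < m →
            pw R p i * pw R q (m ∸ i) ≈ q * (pw R p i * pw R q (m ∸ suc i))
    shift i i<m = begin
      pw R p i * pw R q (m ∸ i)
        ≈⟨ *-congˡ (reflexive (≡.cong (pw R q) (ℕₚ.+-∸-assoc 1 i<m))) ⟩
      pw R p i * (q * pw R q (m ∸ suc i))
        ≈⟨ solve 3 (λ a b c → a :* (b :* c) := b :* (a :* c)) refl _ _ _ ⟩
      q * (pw R p i * pw R q (m ∸ suc i)) ∎

  ⟦suc⟧′ : ∀ m → ⟦ suc m ⟧ ≈ p * ⟦ m ⟧ + pw R q m
  ⟦suc⟧′ zero = begin
    0# + 1# * 1#   ≈⟨ +-cong (sym (zeroʳ p)) (*-identityˡ 1#) ⟩
    p * 0# + 1#    ∎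
  ⟦suc⟧′ (suc m) = begin
    ⟦ suc (suc m) ⟧                                ≈⟨ ⟦suc⟧ (suc m) ⟩
    p * pw R p m + q * ⟦ suc m ⟧                   ≈⟨ +-congˡ (*-congˡ (⟦suc⟧′ m)) ⟩
    p * pw R p m + q * (p * ⟦ m ⟧ + pw R q m)
      ≈⟨ solve 5 (λ p q a n b → p :* a :+ q :* (p :* n :+ b) := p :* (a :+ q :* n) :+ q :* b)
           refl p q (pw R p m) ⟦ m ⟧ (pw R q m) ⟩
    p * (pw R p m + q * ⟦ m ⟧) + q * pw R q m      ≈⟨ +-congʳ (*-congˡ (sym (⟦suc⟧ m))) ⟩
    p * ⟦ suc m ⟧ + q * pw R q m                   ∎

  qbinom-0 : ∀ m → qbinom R p q m 0 ≈ 1#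
  qbinom-0 zero    = refl
  qbinom-0 (suc m) = refl

  qbinom-1 : ∀ m → qbinom R p q m 1 ≈ ⟦ m ⟧
  qbinom-1 zero    = refl
  qbinom-1 (suc m) = begin
    p * 1# * qbinom R p q m 1 + pw R q m * qbinom R p q m 0
      ≈⟨ +-cong (*-cong (*-identityʳ p) (qbinom-1 m)) (*-congˡ (qbinom-0 m)) ⟩
    p * ⟦ m ⟧ + pw R q m * 1#   ≈⟨ +-congˡ (*-identityʳ _) ⟩
    p * ⟦ m ⟧ + pw R q m        ≈⟨ sym (⟦suc⟧′ m) ⟩
    ⟦ suc m ⟧                   ∎

  pairs-suc : ∀ m → pairs (suc m) ≈ p * p * pairs m + pw R q (m ∸ 1) * ⟦ m ⟧
  pairs-suc m = +-cong (*-congʳ (*-congˡ (*-identityʳ p))) (*-congˡ (qbinom-1 m))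

  pairs-1 : pairs 1 ≈ 0#
  pairs-1 = begin
    pairs 1                 ≈⟨ pairs-suc 0 ⟩
    p * p * 0# + 1# * 0#    ≈⟨ +-cong (zeroʳ _) (zeroʳ _) ⟩
    0# + 0#                 ≈⟨ +-identityˡ 0# ⟩
    0#                      ∎

  -- The mirror Pascal recurrence, with p and q exchanged. Induction reduces it to the defining
  -- recurrence and the two recurrences of [m].
  pairs-suc′ : ∀ m → pw R p m * ⟦ suc m ⟧ + q * q * pairs (suc m) ≈ pairs (suc (suc m))
  pairs-suc′ zero = begin
    1# * ⟦ 1 ⟧ + q * q * pairs 1   ≈⟨ +-congˡ (trans (*-congˡ pairs-1) (zeroʳ _)) ⟩
    1# * ⟦ 1 ⟧ + 0#                ≈⟨ +-comm _ _ ⟩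
    0# + 1# * ⟦ 1 ⟧                ≈⟨ +-congʳ (sym (trans (*-congˡ pairs-1) (zeroʳ _))) ⟩
    p * p * pairs 1 + 1# * ⟦ 1 ⟧   ≈⟨ sym (pairs-suc 1) ⟩
    pairs 2                        ∎
  pairs-suc′ (suc m) = begin
    p * a * ⟦ suc (suc m) ⟧ + q * q * pairs (suc (suc m))
      ≈⟨ +-cong (*-congˡ (⟦suc⟧′ (suc m))) (*-congˡ (pairs-suc (suc m))) ⟩
    p * a * (p * n + q * b) + q * q * (p * p * d + b * n)
      ≈⟨ solve 6 (λ p q a b n d → p :* a :* (p :* n :+ q :* b) :+ q :* q :* (p :* p :* d :+ b :* n)
           := p :* p :* (a :* n :+ q :* q :* d) :+ q :* b :* (p :* a :+ q :* n)) refl p q a b n d ⟩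
    p * p * (a * n + q * q * d) + q * b * (p * a + q * n)
      ≈⟨ +-cong (*-congˡ (pairs-suc′ m)) (*-congˡ (sym (⟦suc⟧ (suc m)))) ⟩
    p * p * pairs (suc (suc m)) + q * b * ⟦ suc (suc m) ⟧
      ≈⟨ sym (pairs-suc (suc (suc m))) ⟩
    pairs (suc (suc (suc m))) ∎
    where
    a = pw R p m
    b = pw R q m
    n = ⟦ suc m ⟧
    d = pairs (suc m)

  ⟦suc-suc⟧ : ∀ m → ⟦ suc (suc m) ⟧ ≈ (p + q) * pw R p m + q * q * ⟦ m ⟧
  ⟦suc-suc⟧ m = begin
    ⟦ suc (suc m) ⟧                             ≈⟨ ⟦suc⟧ (suc m) ⟩
    p * pw R p m + q * ⟦ suc m ⟧                ≈⟨ +-congˡ (*-congˡ (⟦suc⟧ m)) ⟩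
    p * pw R p m + q * (pw R p m + q * ⟦ m ⟧)
      ≈⟨ solve 4 (λ p q a n → p :* a :+ q :* (a :+ q :* n) := (p :+ q) :* a :+ q :* q :* n)
           refl p q (pw R p m) ⟦ m ⟧ ⟩
    (p + q) * pw R p m + q * q * ⟦ m ⟧          ∎

  pairs-* : ∀ m → (p + q) * pairs (suc m) ≈ ⟦ suc m ⟧ * ⟦ m ⟧
  pairs-* zero    = trans (*-congˡ pairs-1) (trans (zeroʳ _) (sym (zeroʳ _)))
  pairs-* (suc m) = begin
    (p + q) * pairs (suc (suc m))             ≈⟨ *-congˡ (sym (pairs-suc′ m)) ⟩
    (p + q) * (a * n + q * q * pairs (suc m))
      ≈⟨ solve 5 (λ s q a n d → s :* (a :* n :+ q :* q :* d) := s :* a :* n :+ q :* q :* (s :* d))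
           refl (p + q) q a n (pairs (suc m)) ⟩
    (p + q) * a * n + q * q * ((p + q) * pairs (suc m))  ≈⟨ +-congˡ (*-congˡ (pairs-* m)) ⟩
    (p + q) * a * n + q * q * (n * ⟦ m ⟧)
      ≈⟨ solve 5 (λ s q a n k → s :* a :* n :+ q :* q :* (n :* k) := (s :* a :+ q :* q :* k) :* n)
           refl (p + q) q a n ⟦ m ⟧ ⟩
    ((p + q) * a + q * q * ⟦ m ⟧) * n         ≈⟨ *-congʳ (sym (⟦suc-suc⟧ m)) ⟩
    ⟦ suc (suc m) ⟧ * n                       ∎
    where
    a = pw R p m
    n = ⟦ suc m ⟧

  -- Multiplied by p + q, both sides become [m+2][m+1][m]. As p + q cannot be cancelled, [m+2] is
  -- expanded so that only one copy of binom(m+1,2) absorbs p + q.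
  pairs-exchange : ∀ m → ⟦ suc (suc m) ⟧ * pairs (suc m) ≈ pairs (suc (suc m)) * ⟦ m ⟧
  pairs-exchange m = begin
    ⟦ suc (suc m) ⟧ * d                          ≈⟨ *-congʳ (⟦suc-suc⟧ m) ⟩
    ((p + q) * a + q * q * ⟦ m ⟧) * d
      ≈⟨ solve 5 (λ s q a k d → (s :* a :+ q :* q :* k) :* d := a :* (s :* d) :+ q :* q :* d :* k)
           refl (p + q) q a ⟦ m ⟧ d ⟩
    a * ((p + q) * d) + q * q * d * ⟦ m ⟧        ≈⟨ +-congʳ (*-congˡ (pairs-* m)) ⟩
    a * (⟦ suc m ⟧ * ⟦ m ⟧) + q * q * d * ⟦ m ⟧
      ≈⟨ solve 4 (λ a n k e → a :* (n :* k) :+ e :* k := (a :* n :+ e) :* k)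
           refl a ⟦ suc m ⟧ ⟦ m ⟧ (q * q * d) ⟩
    (a * ⟦ suc m ⟧ + q * q * d) * ⟦ m ⟧          ≈⟨ *-congʳ (pairs-suc′ m) ⟩
    pairs (suc (suc m)) * ⟦ m ⟧                  ∎
    where
    a = pw R p m
    d = pairs (suc m)

  -- [m]!/(p + q)^h for m slots and h hooks, written without division.
  potential : Skeleton → C
  potential []             = 1#
  potential (letter a ∷ S) = potential S
  potential (slot ∷ S)     = ⟦ suc (slots S) ⟧ * potential S
  potential (hook b ∷ S)   = pairs (suc (suc (slots S))) * potential S

  -- Removes the fill term at m = 0, where `continue` would read `pred 0` and prolong a finished
  -- word.
  positive : ℕ → C
  positive zero    = 0#
  positive (suc m) = 1#

  -- The weights φ of the three kinds stay arbitrary because the induction over skeletons changes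
  -- them: passing beneath a token multiplies each by a factor depending on the kind.
  eigenvalue : (Kind → C) → ℕ → C
  eigenvalue φ m = positive m * φ fill + (⟦ m ⟧ * φ extend + pairs (suc m) * φ split)

  eigenvalue-0 : ∀ φ → eigenvalue φ 0 ≈ 0#
  eigenvalue-0 φ = trans
    (+-cong (zeroˡ _) (+-cong (zeroˡ _) (trans (*-congʳ pairs-1) (zeroˡ _))))
    (trans (+-identityˡ _) (+-identityˡ _))

  term : (Kind → C) → Option → C
  term φ (κ , r , l , S) = pw R p r * (pw R q l * (φ κ * potential S))

  positive-* : ∀ m {a} → (m ≡ 0 → a ≈ 0#) → positive m * a ≈ a
  positive-* zero    a≈0 = trans (zeroˡ _) (sym (a≈0 ≡.refl))
  positive-* (suc m) a≈0 = *-identityˡ _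

  pw-+ : ∀ a m n → pw R a (m ℕ.+ n) ≈ pw R a m * pw R a n
  pw-+ a zero    n = sym (*-identityˡ _)
  pw-+ a (suc m) n = trans (*-congˡ (pw-+ a m n)) (sym (*-assoc _ _ _))

  -- The potential factor of τ depends only on the number of slots behind it, and `Move-slots` makes
  -- that number after the move a function of the kind. So q^d and this factor are absorbed into the
  -- weights ψ.
  beneath-sum : ∀ {x} φ ψ τ d (h : ℕ → C) S →
    (∀ T → potential (τ ∷ T) ≈ h (suc (slots T)) * potential T) →
    (∀ κ → ψ κ ≈ pw R q d * (φ κ * h (grow κ (slots S)))) →
    sumList R (term ψ) (moves x S) ≈ eigenvalue ψ (slots S) * potential S →
    sumList R (term φ) (map (beneath τ d) (moves x S)) ≈ eigenvalue ψ (slots S) * potential S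
  beneath-sum {x} φ ψ τ d h S pot ψ-def ih = trans (sumList-map _ _ (moves x S))
    (trans (sumList-cong (moves x S) same) ih)
    where
    same : ∀ {o} → o ∈ moves x S → term φ (beneath τ d o) ≈ term ψ o
    same {κ , r , l , T} o∈ = *-congˡ (begin
      pw R q (d ℕ.+ l) * (φ κ * potential (τ ∷ T))
        ≈⟨ *-cong (pw-+ q d l) (*-congˡ (pot T)) ⟩
      pw R q d * pw R q l * (φ κ * (h (suc (slots T)) * potential T))
        ≈⟨ *-congˡ (*-congˡ (*-congʳ (reflexive (≡.cong h (Move-slots (∈-moves⁻ S o∈)))))) ⟩
      pw R q d * pw R q l * (φ κ * (h (grow κ (slots S)) * potential T))
        ≈⟨ solve 5 (λ a b c e f → a :* b :* (c :* (e :* f)) := b :* (a :* (c :* e) :* f))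
             refl _ _ _ _ _ ⟩
      pw R q l * (pw R q d * (φ κ * h (grow κ (slots S))) * potential T)
        ≈⟨ *-congˡ (*-congʳ (sym (ψ-def κ))) ⟩
      pw R q l * (ψ κ * potential T) ∎)

  -- The eigenvector property, by induction on S for all φ at once. Moves at the first token carry
  -- p^m; the rest are an instance with weights ψ. Comparing the coefficients of the three φ leaves
  -- one identity for each kind.
  moves-sum : ∀ x S φ → sumList R (term φ) (moves x S) ≈ eigenvalue φ (slots S) * potential S
  moves-sum x [] φ = sym (trans (*-congʳ (eigenvalue-0 φ)) (zeroˡ _))
  moves-sum x (letter a ∷ S) φ = beneath-sum φ φ (letter a) 0 (λ _ → 1#) S
    (λ T → sym (*-identityˡ _)) (λ κ → sym (trans (*-identityˡ _) (*-identityʳ _)))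
    (moves-sum x S φ)
  moves-sum x (slot ∷ S) φ = begin
    sumList R (term φ) (placements x [] S ++ map (beneath slot 1) (moves x S))
      ≈⟨ sumList-++ (term φ) (placements x [] S) (map (beneath slot 1) (moves x S)) ⟩
    (a * (1# * (φ fill * G)) + (a * (1# * (φ extend * (⟦ suc m ⟧ * G)))
      + (a * (1# * (φ split * (pairs (suc (suc m)) * G))) + 0#)))
      + sumList R (term φ) (map (beneath slot 1) (moves x S))
      ≈⟨ +-cong (+-cong (*-congˡ (*-identityˡ _)) (+-cong (*-congˡ (*-identityˡ _))
           (trans (+-identityʳ _) (*-congˡ (*-identityˡ _)))))
         (beneath-sum φ ψ slot 1 ⟦_⟧ S (λ T → refl) (λ κ → *-congʳ (sym (*-identityʳ q)))
           (moves-sum x S ψ)) ⟩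
    (a * (φ fill * G) + (a * (φ extend * (⟦ suc m ⟧ * G))
      + a * (φ split * (pairs (suc (suc m)) * G)))) +
    (positive m * (q * (φ fill * ⟦ m ⟧)) + (⟦ m ⟧ * (q * (φ extend * ⟦ suc m ⟧))
      + pairs (suc m) * (q * (φ split * ⟦ suc (suc m) ⟧)))) * G
      ≈⟨ solve 12 (λ a q m₀ m₁ m₂ d₁ d₂ δ φ₁ φ₂ φ₃ G →
           (a :* (φ₁ :* G) :+ (a :* (φ₂ :* (m₁ :* G)) :+ a :* (φ₃ :* (d₂ :* G)))) :+
           (δ :* (q :* (φ₁ :* m₀)) :+ (m₀ :* (q :* (φ₂ :* m₁)) :+ d₁ :* (q :* (φ₃ :* m₂)))) :* G
           := ((a :+ q :* (δ :* m₀)) :* φ₁ :+ ((a :+ q :* m₀) :* m₁ :* φ₂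
               :+ (a :* d₂ :+ q :* (m₂ :* d₁)) :* φ₃)) :* G)
         refl a q ⟦ m ⟧ ⟦ suc m ⟧ ⟦ suc (suc m) ⟧ (pairs (suc m)) (pairs (suc (suc m)))
         (positive m) (φ fill) (φ extend) (φ split) G ⟩
    ((a + q * (positive m * ⟦ m ⟧)) * φ fill + ((a + q * ⟦ m ⟧) * ⟦ suc m ⟧ * φ extend
      + (a * pairs (suc (suc m)) + q * (⟦ suc (suc m) ⟧ * pairs (suc m))) * φ split)) * G
      ≈⟨ *-congʳ (+-cong
           -- The factor `positive m` is absorbed because [0] = 0; in the hook case below binom(1,2)
           -- = 0 does the same.
           (*-congʳ (trans (+-congˡ (*-congˡ (positive-* m ⟦0⟧))) (sym (⟦suc⟧ m))))
           (+-cong (*-congʳ (*-congʳ (sym (⟦suc⟧ m)))) (*-congʳ split-coefficient))) ⟩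
    (⟦ suc m ⟧ * φ fill + (⟦ suc m ⟧ * ⟦ suc m ⟧ * φ extend
      + pairs (suc (suc m)) * ⟦ suc m ⟧ * φ split)) * G
      ≈⟨ *-congʳ (+-congʳ (*-congˡ (sym (*-identityˡ _)))) ⟩
    (⟦ suc m ⟧ * (1# * φ fill) + (⟦ suc m ⟧ * ⟦ suc m ⟧ * φ extend
      + pairs (suc (suc m)) * ⟦ suc m ⟧ * φ split)) * G
      ≈⟨ solve 6 (λ n d u φ₂ φ₃ G → (n :* u :+ (n :* n :* φ₂ :+ d :* n :* φ₃)) :* G
           := (u :+ (n :* φ₂ :+ d :* φ₃)) :* (n :* G)) refl _ _ _ _ _ _ ⟩
    eigenvalue φ (suc m) * (⟦ suc m ⟧ * G) ∎
    where
    m = slots S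
    a = pw R p m
    G = potential S
    ψ : Kind → C
    ψ κ = q * (φ κ * ⟦ grow κ m ⟧)
    ⟦0⟧ : m ≡ 0 → ⟦ m ⟧ ≈ 0#
    ⟦0⟧ eq = reflexive (≡.cong ⟦_⟧ eq)
    split-coefficient : a * pairs (suc (suc m)) + q * (⟦ suc (suc m) ⟧ * pairs (suc m))
                        ≈ pairs (suc (suc m)) * ⟦ suc m ⟧
    split-coefficient = begin
      a * pairs (suc (suc m)) + q * (⟦ suc (suc m) ⟧ * pairs (suc m))
        ≈⟨ +-congˡ (*-congˡ (pairs-exchange m)) ⟩
      a * pairs (suc (suc m)) + q * (pairs (suc (suc m)) * ⟦ m ⟧)
        ≈⟨ solve 4 (λ a q d n → a :* d :+ q :* (d :* n) := d :* (a :+ q :* n)) refl _ _ _ _ ⟩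
      pairs (suc (suc m)) * (a + q * ⟦ m ⟧)   ≈⟨ *-congˡ (sym (⟦suc⟧ m)) ⟩
      pairs (suc (suc m)) * ⟦ suc m ⟧         ∎
  moves-sum x (hook b ∷ S) φ = begin
    sumList R (term φ) (placements x U S ++ map (beneath (hook b) 2) (moves x S))
      ≈⟨ sumList-++ (term φ) (placements x U S) (map (beneath (hook b) 2) (moves x S)) ⟩
    (a * (1# * (φ fill * (m₁ * G))) + (a * (1# * (φ extend * (m₂ * (m₁ * G))))
      + (a * (1# * (φ split * (m₃ * (d₂ * G)))) + 0#)))
      + sumList R (term φ) (map (beneath (hook b) 2) (moves x S))
      ≈⟨ +-cong (+-cong (*-congˡ (*-identityˡ _)) (+-cong (*-congˡ (*-identityˡ _))
           (trans (+-identityʳ _) (*-congˡ (*-identityˡ _)))))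
         (beneath-sum φ ψ (hook b) 2 (pairs ∘ suc) S (λ T → refl)
           (λ κ → *-congʳ (*-congˡ (sym (*-identityʳ q)))) (moves-sum x S ψ)) ⟩
    (a * (φ fill * (m₁ * G)) + (a * (φ extend * (m₂ * (m₁ * G)))
      + a * (φ split * (m₃ * (d₂ * G))))) +
    (positive m * (q * q * (φ fill * d₁)) + (m₀ * (q * q * (φ extend * d₂))
      + d₁ * (q * q * (φ split * d₃)))) * G
      ≈⟨ solve 14 (λ a q m₀ m₁ m₂ m₃ d₁ d₂ d₃ δ φ₁ φ₂ φ₃ G →
           (a :* (φ₁ :* (m₁ :* G)) :+ (a :* (φ₂ :* (m₂ :* (m₁ :* G)))
             :+ a :* (φ₃ :* (m₃ :* (d₂ :* G))))) :+
           (δ :* (q :* q :* (φ₁ :* d₁)) :+ (m₀ :* (q :* q :* (φ₂ :* d₂))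
             :+ d₁ :* (q :* q :* (φ₃ :* d₃)))) :* G
           := ((a :* m₁ :+ q :* q :* (δ :* d₁)) :* φ₁
               :+ ((a :* (m₂ :* m₁) :+ q :* q :* m₀ :* d₂) :* φ₂
               :+ (a :* (m₃ :* d₂) :+ q :* q :* d₁ :* d₃) :* φ₃)) :* G)
         refl a q m₀ m₁ m₂ m₃ d₁ d₂ d₃ (positive m) (φ fill) (φ extend) (φ split) G ⟩
    ((a * m₁ + q * q * (positive m * d₁)) * φ fill
      + ((a * (m₂ * m₁) + q * q * m₀ * d₂) * φ extend
      + (a * (m₃ * d₂) + q * q * d₁ * d₃) * φ split)) * G
      ≈⟨ *-congʳ (+-cong
           (*-congʳ (trans (+-congˡ (*-congˡ (positive-* m no-pairs))) (pairs-suc′ m)))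
           (+-cong (*-congʳ extend-coefficient) (*-congʳ split-coefficient))) ⟩
    (d₂ * φ fill + (m₂ * d₂ * φ extend + d₃ * d₂ * φ split)) * G
      ≈⟨ *-congʳ (+-congʳ (*-congˡ (sym (*-identityˡ _)))) ⟩
    (d₂ * (1# * φ fill) + (m₂ * d₂ * φ extend + d₃ * d₂ * φ split)) * G
      ≈⟨ solve 7 (λ n d e u φ₂ φ₃ G → (d :* u :+ (n :* d :* φ₂ :+ e :* d :* φ₃)) :* G
           := (u :+ (n :* φ₂ :+ e :* φ₃)) :* (d :* G)) refl _ _ _ _ _ _ _ ⟩
    eigenvalue φ (suc (suc m)) * (d₂ * G) ∎
    where
    U = slot ∷ letter b ∷ []
    m = slots S
    m₀ = ⟦ m ⟧
    m₁ = ⟦ suc m ⟧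
    m₂ = ⟦ suc (suc m) ⟧
    m₃ = ⟦ suc (suc (suc m)) ⟧
    d₁ = pairs (suc m)
    d₂ = pairs (suc (suc m))
    d₃ = pairs (suc (suc (suc m)))
    a = pw R p m
    G = potential S
    ψ : Kind → C
    ψ κ = q * q * (φ κ * pairs (suc (grow κ m)))
    no-pairs : m ≡ 0 → d₁ ≈ 0#
    no-pairs eq = trans (reflexive (≡.cong (pairs ∘ suc) eq)) pairs-1
    extend-coefficient : a * (m₂ * m₁) + q * q * m₀ * d₂ ≈ m₂ * d₂
    extend-coefficient = begin
      a * (m₂ * m₁) + q * q * m₀ * d₂          ≈⟨ +-congʳ (*-congˡ (sym (pairs-* (suc m)))) ⟩
      a * ((p + q) * d₂) + q * q * m₀ * d₂
        ≈⟨ solve 4 (λ a s d e → a :* (s :* d) :+ e :* d := (s :* a :+ e) :* d)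
             refl a (p + q) d₂ (q * q * m₀) ⟩
      ((p + q) * a + q * q * m₀) * d₂          ≈⟨ *-congʳ (sym (⟦suc-suc⟧ m)) ⟩
      m₂ * d₂                                  ∎
    split-coefficient : a * (m₃ * d₂) + q * q * d₁ * d₃ ≈ d₃ * d₂
    split-coefficient = begin
      a * (m₃ * d₂) + q * q * d₁ * d₃   ≈⟨ +-congʳ (*-congˡ (pairs-exchange (suc m))) ⟩
      a * (d₃ * m₁) + q * q * d₁ * d₃
        ≈⟨ solve 4 (λ a d n e → a :* (d :* n) :+ e :* d := d :* (a :* n :+ e))
             refl a d₃ m₁ (q * q * d₁) ⟩
      d₃ * (a * m₁ + q * q * d₁)        ≈⟨ *-congˡ (pairs-suc′ m) ⟩
      d₃ * d₂                           ∎

-- Formal power series and the geometric series.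

module PowerSeries {c ℓ : Level} (R : CommutativeSemiring c ℓ) where
  open CommutativeSemiring R renaming (Carrier to C)
  open import Algebra.Solver.Ring.NaturalCoefficients.Default R using (solve; _:=_; _:+_; _:*_)
  open import Relation.Binary.Reasoning.Setoid setoid
  open Sums R

  infixl 7 _✶_
  _✶_ : Series R → Series R → Series R
  _✶_ = _⊛_ R

  shift : Series R → Series R
  shift f zero    = 0#
  shift f (suc n) = f n

  ✶-cong : ∀ {f f′ g g′ : Series R} → (∀ n → f n ≈ f′ n) → (∀ n → g n ≈ g′ n) →
           ∀ n → (f ✶ g) n ≈ (f′ ✶ g′) n
  ✶-cong f≈ g≈ n = sumTo-cong (suc n) (λ i _ → *-cong (f≈ i) (g≈ (n ∸ i)))

  ✶-suc : ∀ (f g : Series R) n → (f ✶ g) (suc n) ≈ f 0 * g (suc n) + (f ∘ suc ✶ g) n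
  ✶-suc f g n = sumTo-head (suc n) (λ i → f i * g (suc n ∸ i))

  ✶-zero : ∀ (f g : Series R) → (f ✶ g) 0 ≈ f 0 * g 0
  ✶-zero f g = +-identityˡ _

  ✶-distribʳ : ∀ (f h g : Series R) n → ((λ i → f i + h i) ✶ g) n ≈ (f ✶ g) n + (h ✶ g) n
  ✶-distribʳ f h g n = trans (sumTo-cong (suc n) (λ i _ → distribʳ _ _ _)) (sumTo-+ (suc n) _ _)

  ✶-scaleˡ : ∀ a (f g : Series R) n → ((λ i → a * f i) ✶ g) n ≈ a * (f ✶ g) n
  ✶-scaleˡ a f g n = trans (sumTo-cong (suc n) (λ i _ → *-assoc _ _ _)) (sumTo-*ˡ a (suc n) _)

  ✶-assoc : ∀ (f g h : Series R) n → (f ✶ g ✶ h) n ≈ (f ✶ (g ✶ h)) n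
  ✶-assoc f g h zero = begin
    (f ✶ g ✶ h) 0             ≈⟨ trans (✶-zero (f ✶ g) h) (*-congʳ (✶-zero f g)) ⟩
    f 0 * g 0 * h 0           ≈⟨ *-assoc _ _ _ ⟩
    f 0 * (g 0 * h 0)         ≈⟨ sym (trans (✶-zero f (g ✶ h)) (*-congˡ (✶-zero g h))) ⟩
    (f ✶ (g ✶ h)) 0           ∎
  ✶-assoc f g h (suc n) = begin
    (f ✶ g ✶ h) (suc n)
      ≈⟨ ✶-suc (f ✶ g) h n ⟩
    (f ✶ g) 0 * h (suc n) + ((f ✶ g) ∘ suc ✶ h) n
      ≈⟨ +-cong (*-congʳ (✶-zero f g)) (✶-cong {g = h} (✶-suc f g) (λ _ → refl) n) ⟩
    f 0 * g 0 * h (suc n) + ((λ i → f 0 * g (suc i) + (f ∘ suc ✶ g) i) ✶ h) n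
      ≈⟨ +-congˡ (trans (✶-distribʳ (λ i → f 0 * g (suc i)) (f ∘ suc ✶ g) h n)
           (+-cong (✶-scaleˡ (f 0) (g ∘ suc) h n) (✶-assoc (f ∘ suc) g h n))) ⟩
    f 0 * g 0 * h (suc n) + (f 0 * (g ∘ suc ✶ h) n + (f ∘ suc ✶ (g ✶ h)) n)
      ≈⟨ solve 5 (λ a b c d e → a :* b :* c :+ (a :* d :+ e) := a :* (b :* c :+ d) :+ e)
           refl _ _ _ _ _ ⟩
    f 0 * (g 0 * h (suc n) + (g ∘ suc ✶ h) n) + (f ∘ suc ✶ (g ✶ h)) n
      ≈⟨ +-congʳ (*-congˡ (sym (✶-suc g h n))) ⟩
    f 0 * (g ✶ h) (suc n) + (f ∘ suc ✶ (g ✶ h)) n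
      ≈⟨ sym (✶-suc f (g ✶ h) n) ⟩
    (f ✶ (g ✶ h)) (suc n) ∎

  ✶-identityʳ : ∀ (f : Series R) n → (f ✶ one R) n ≈ f n
  ✶-identityʳ f n = begin
    sumTo R n (λ i → f i * one R (n ∸ i)) + f n * one R (n ∸ n)
      ≈⟨ +-cong (sumTo-zero n (λ i i<n → trans (*-congˡ (reflexive
             (≡.cong (one R) (ℕₚ.+-∸-assoc 1 i<n)))) (zeroʳ _)))
           (*-congˡ (reflexive (≡.cong (one R) (ℕₚ.n∸n≡0 n)))) ⟩
    0# + f n * 1#   ≈⟨ trans (+-identityˡ _) (*-identityʳ _) ⟩
    f n             ∎

  ✶-identityˡ : ∀ (g : Series R) n → (one R ✶ g) n ≈ g n
  ✶-identityˡ g zero    = trans (✶-zero (one R) g) (*-identityˡ _)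
  ✶-identityˡ g (suc n) = begin
    (one R ✶ g) (suc n)                      ≈⟨ ✶-suc (one R) g n ⟩
    1# * g (suc n) + (one R ∘ suc ✶ g) n
      ≈⟨ +-cong (*-identityˡ _) (sumTo-zero (suc n) (λ i _ → zeroˡ _)) ⟩
    g (suc n) + 0#                           ≈⟨ +-identityʳ _ ⟩
    g (suc n)                                ∎

  ✶-shift : ∀ (f g : Series R) n → (f ✶ shift g) n ≈ shift (f ✶ g) n
  ✶-shift f g zero    = trans (✶-zero f (shift g)) (zeroʳ _)
  ✶-shift f g (suc n) = begin
    sumTo R (suc n) (λ i → f i * shift g (suc n ∸ i)) + f (suc n) * shift g (n ∸ n)
      ≈⟨ +-cong (sumTo-cong (suc n) (λ i i≤n → *-congˡ (reflexive
             (≡.cong (shift g) (ℕₚ.+-∸-assoc 1 (ℕ.s≤s⁻¹ i≤n))))))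
           (trans (*-congˡ (reflexive (≡.cong (shift g) (ℕₚ.n∸n≡0 n)))) (zeroʳ _)) ⟩
    (f ✶ g) n + 0#   ≈⟨ +-identityʳ _ ⟩
    (f ✶ g) n        ∎

  module _ (u : Series R) (u₀≈0 : u 0 ≈ 0#) where

    ✶-suc₀ : ∀ g n → (u ✶ g) (suc n) ≈ (u ∘ suc ✶ g) n
    ✶-suc₀ g n = trans (✶-suc u g n)
      (trans (+-congʳ (trans (*-congʳ u₀≈0) (zeroˡ _))) (+-identityˡ _))

    ✶-zero₀ : ∀ g → (u ✶ g) 0 ≈ 0#
    ✶-zero₀ g = trans (✶-zero u g) (trans (*-congʳ u₀≈0) (zeroˡ _))

    spow-order : ∀ k {n} → n < k → spow R u k n ≈ 0#
    spow-order (suc k) {zero}  _         = ✶-zero₀ (spow R u k)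
    spow-order (suc k) {suc n} (s≤s n<k) = trans (✶-suc₀ (spow R u k) n)
      (sumTo-zero (suc n) (λ i _ → trans
        (*-congˡ (spow-order k (ℕₚ.≤-<-trans (ℕₚ.m∸n≤m n i) n<k))) (zeroʳ _)))

    -- In u ✶ geom u the cutoff of `geom` varies with the coefficient. Powers beyond it vanish by
    -- order, so a common cutoff can be used and the two sums exchanged in `geom-unfold`.
    geom-truncation : ∀ j n → sumTo R (suc (j ℕ.+ n)) (λ k → spow R u k n) ≈ geom R u n
    geom-truncation zero    n = refl
    geom-truncation (suc j) n = trans
      (+-cong (geom-truncation j n) (spow-order (suc (j ℕ.+ n)) (s≤s (ℕₚ.m≤n+m n j))))
      (+-identityʳ _)

    geom-unfold : ∀ n → geom R u n ≈ one R n + (u ✶ geom R u) n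
    geom-unfold zero = trans (+-comm _ _) (+-congˡ (sym (✶-zero₀ (geom R u))))
    geom-unfold (suc n) = trans (sumTo-head (suc n) (λ k → spow R u k (suc n))) (+-congˡ (sym (begin
      (u ✶ geom R u) (suc n)
        ≈⟨ ✶-suc₀ (geom R u) n ⟩
      sumTo R (suc n) (λ i → u (suc i) * geom R u (n ∸ i))
        ≈⟨ sumTo-cong (suc n) (λ i i≤n → trans
             (*-congˡ (sym (untruncated i (ℕ.s≤s⁻¹ i≤n)))) (sym (sumTo-*ˡ _ (suc n) _))) ⟩
      sumTo R (suc n) (λ i → sumTo R (suc n) (λ k → u (suc i) * spow R u k (n ∸ i)))
        ≈⟨ sumTo-swap (suc n) (suc n) _ ⟩
      sumTo R (suc n) (λ k → (u ∘ suc ✶ spow R u k) n)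
        ≈⟨ sumTo-cong (suc n) (λ k _ → sym (✶-suc₀ (spow R u k) n)) ⟩
      sumTo R (suc n) (λ k → spow R u (suc k) (suc n)) ∎)))
      where
      untruncated : ∀ i → i ≤ n →
        sumTo R (suc n) (λ k → spow R u k (n ∸ i)) ≈ geom R u (n ∸ i)
      untruncated i i≤n = trans
        (reflexive (≡.cong (λ N → sumTo R (suc N) (λ k → spow R u k (n ∸ i)))
          (≡.sym (ℕₚ.m+[n∸m]≡n i≤n))))
        (geom-truncation i (n ∸ i))

-- The J-fraction as a generating function of weighted paths.

module ContinuedFraction {c ℓ : Level} (R : CommutativeSemiring c ℓ)
                         (p q t : CommutativeSemiring.Carrier R) where
  open CommutativeSemiring R renaming (Carrier to C)
  open import Relation.Binary.Reasoning.Setoid setoid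
  open Sums R
  open PowerSeries R
  open Gaussian R p q

  -- The weighted number of ways to fill a skeleton with m slots in k insertions,
  -- divided by its potential.
  mutual
    completions : ℕ → ℕ → C
    completions zero    zero    = 1#
    completions zero    (suc m) = 0#
    completions (suc k) m       = eigenvalue (continue k m) m

    continue : ℕ → ℕ → Kind → C
    continue k m fill   = completions k (pred m)
    continue k m extend = completions k m
    continue k m split  = t * completions k (suc m)

  tail : ℕ → ℕ → Series R
  tail m d zero          = 0#
  tail m d (suc zero)    = ⟦ suc m ⟧
  tail m d (suc (suc k)) = pairs (suc (suc m)) * t * cf R p q t (suc m) d k

  cf-unfold : ∀ m d n → cf R p q t m (suc d) n ≈ one R n + (tail m d ✶ cf R p q t m (suc d)) n
  cf-unfold m d n = trans (geom-unfold _ refl n) (+-congˡ (✶-cong {g = cf R p q t m (suc d)}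
    (λ { zero → refl ; (suc zero) → refl ; (suc (suc k)) → refl }) (λ _ → refl) n))

  -- One factor x of the quadratic term is moved onto g. In this form, shift (F ✶ shift g), it is
  -- literally the next level of `descents`.
  tail-✶ : ∀ m d g n → (tail m d ✶ g) n ≈
    ⟦ suc m ⟧ * shift g n + pairs (suc (suc m)) * t * shift (cf R p q t (suc m) d ✶ shift g) n
  tail-✶ m d g zero = trans (✶-zero₀ (tail m d) refl g)
    (sym (trans (+-cong (zeroʳ _) (zeroʳ _)) (+-identityˡ _)))
  tail-✶ m d g (suc zero) = begin
    (tail m d ✶ g) 1           ≈⟨ trans (✶-suc₀ (tail m d) refl g 0) (✶-zero (tail m d ∘ suc) g) ⟩
    ⟦ suc m ⟧ * g 0            ≈⟨ sym (+-identityʳ _) ⟩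
    ⟦ suc m ⟧ * g 0 + 0#       ≈⟨ +-congˡ (sym (trans (*-congˡ (✶-shift F g 0)) (zeroʳ _))) ⟩
    ⟦ suc m ⟧ * g 0 + pairs (suc (suc m)) * t * (F ✶ shift g) 0 ∎
    where F = cf R p q t (suc m) d
  tail-✶ m d g (suc (suc n)) = begin
    (tail m d ✶ g) (suc (suc n))
      ≈⟨ trans (✶-suc₀ (tail m d) refl g (suc n)) (✶-suc (tail m d ∘ suc) g n) ⟩
    ⟦ suc m ⟧ * g (suc n) + ((λ i → pairs (suc (suc m)) * t * F i) ✶ g) n
      ≈⟨ +-congˡ (trans (✶-scaleˡ _ F g n) (*-congˡ (sym (✶-shift F g (suc n))))) ⟩
    ⟦ suc m ⟧ * g (suc n) + pairs (suc (suc m)) * t * (F ✶ shift g) (suc n) ∎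
    where F = cf R p q t (suc m) d

  -- Paths from height m to height 0, cut at their first visits to the heights
  -- m - 1, …, 0; the truncation restricts them to heights at most d.
  descents : ℕ → ℕ → Series R
  descents d zero    = one R
  descents d (suc m) = shift (cf R p q t m (d ∸ m) ✶ descents d m)

  -- Decomposition by the first step: down, level, or up. The hypothesis m < d leaves the truncated
  -- fraction a level to unfold.
  descents-suc : ∀ {d m} → m < d → ∀ n → descents d (suc m) (suc n) ≈
    descents d m n + (⟦ suc m ⟧ * descents d (suc m) n
      + pairs (suc (suc m)) * t * descents d (suc (suc m)) n)
  descents-suc {d} {m} m<d n = begin
    (cf R p q t m (d ∸ m) ✶ P) n
      ≈⟨ reflexive (≡.cong (λ e → (cf R p q t m e ✶ P) n) d∸m) ⟩
    (F ✶ P) n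
      ≈⟨ ✶-cong {g = P} (cf-unfold m e) (λ _ → refl) n ⟩
    ((λ i → one R i + (tail m e ✶ F) i) ✶ P) n
      ≈⟨ ✶-distribʳ (one R) (tail m e ✶ F) P n ⟩
    (one R ✶ P) n + (tail m e ✶ F ✶ P) n
      ≈⟨ +-cong (✶-identityˡ P n) (✶-assoc (tail m e) F P n) ⟩
    P n + (tail m e ✶ (F ✶ P)) n
      ≈⟨ +-congˡ (tail-✶ m e (F ✶ P) n) ⟩
    P n + (⟦ suc m ⟧ * shift (F ✶ P) n
      + pairs (suc (suc m)) * t * shift (cf R p q t (suc m) e ✶ shift (F ✶ P)) n)
      ≈⟨ reflexive (≡.cong (λ z → P n + (⟦ suc m ⟧ * shift (cf R p q t m z ✶ P) n
           + pairs (suc (suc m)) * t * shift (cf R p q t (suc m) e ✶ shift (cf R p q t m z ✶ P)) n))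
           (≡.sym d∸m)) ⟩
    P n + (⟦ suc m ⟧ * descents d (suc m) n
      + pairs (suc (suc m)) * t * descents d (suc (suc m)) n) ∎
    where
    e = d ∸ suc m
    d∸m : d ∸ m ≡ suc e
    d∸m = ℕₚ.+-∸-assoc 1 m<d
    P = descents d m
    F = cf R p q t m (suc e)

  -- An up-step trades a unit of k for a unit of m, so the bound on k + m survives every step, and
  -- it supplies the m < d needed for unfolding.
  descents≈completions : ∀ d k m → k ℕ.+ m ≤ suc d → descents d m k ≈ completions k m
  descents≈completions d zero    zero    _ = refl
  descents≈completions d zero    (suc m) _ = refl
  descents≈completions d (suc k) zero    _ = sym (eigenvalue-0 (continue k 0))
  descents≈completions d (suc k) (suc m) k+m≤d = begin
    descents d (suc m) (suc k)
      ≈⟨ descents-suc (ℕₚ.≤-trans (ℕₚ.m≤n+m (suc m) k) (ℕ.s≤s⁻¹ k+m≤d)) k ⟩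
    descents d m k + (⟦ suc m ⟧ * descents d (suc m) k
      + pairs (suc (suc m)) * t * descents d (suc (suc m)) k)
      ≈⟨ +-cong (descents≈completions d k m (ℕₚ.≤-trans (ℕₚ.+-mono-≤ (ℕₚ.n≤1+n k) (ℕₚ.n≤1+n m)) k+m≤d))
           (+-cong (*-congˡ (descents≈completions d k (suc m) (ℕₚ.≤-trans (ℕₚ.n≤1+n _) k+m≤d)))
                   (*-congˡ (descents≈completions d k (suc (suc m))
                     (ℕₚ.≤-trans (ℕₚ.≤-reflexive (ℕₚ.+-suc k (suc m))) k+m≤d)))) ⟩
    completions k m + (⟦ suc m ⟧ * completions k (suc m)
      + pairs (suc (suc m)) * t * completions k (suc (suc m)))
      ≈⟨ +-cong (sym (*-identityˡ _)) (+-congˡ (*-assoc _ _ _)) ⟩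
    completions (suc k) (suc m) ∎

  -- Level m of the fraction corresponds to m + 1 slots. The passage from x^n to n + 1 insertions is
  -- the final step from one slot to none, of weight 1: the letter n + 1 fills the last slot.
  D≈completions : ∀ n → D R p q t (suc n) ≈ completions (suc n) 1
  D≈completions n = trans (sym (✶-identityʳ (cf R p q t 0 (suc n)) n))
    (descents≈completions (suc n) (suc n) 1 (ℕₚ.≤-reflexive (ℕₚ.+-comm (suc n) 1)))

-- Each descent is followed by an ascent inside the word, since it can be neither followed by a
-- descent nor last. Pairing the two gives twice des at most n - 1.
Smooth⇒des : ∀ a w → Smooth (a ∷ w) → All (0 <_) w → des (a ∷ w) ℕ.+ des (a ∷ w) ≤ length w
Smooth⇒des a [] _ _ = z≤n
Smooth⇒des a (b ∷ w) (ok , smooth) (0<b ∷ 0<w) with b ℕₚ.<? a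
... | no b≮a rewrite ≤⇒<ᵇ≡false (ℕₚ.≮⇒≥ b≮a) = ℕₚ.m≤n⇒m≤1+n (Smooth⇒des b w smooth 0<w)
Smooth⇒des a (b ∷ []) (ok , smooth) (0<b ∷ 0<w) | yes b<a = contradiction 0<b (ℕₚ.≤⇒≯ (ok b<a))
Smooth⇒des a (b ∷ c ∷ w) (ok , _ , smooth) (0<b ∷ _ ∷ 0<w) | yes b<a
  rewrite <⇒<ᵇ≡true b<a | ≤⇒<ᵇ≡false (ok b<a) | ℕₚ.+-suc (des (c ∷ w)) (des (c ∷ w)) =
  s≤s (s≤s (Smooth⇒des c w smooth 0<w))

andre-des : ∀ n {σ} → σ ∈ andre n → des σ ≤ ⌊ n ∸ 1 /2⌋
andre-des n {[]}    _  = z≤n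
andre-des n {a ∷ w} σ∈ = begin
  des (a ∷ w)                          ≡⟨ ℕₚ.n≡⌊n+n/2⌋ (des (a ∷ w)) ⟩
  ⌊ des (a ∷ w) ℕ.+ des (a ∷ w) /2⌋
    ≤⟨ ℕₚ.⌊n/2⌋-mono (Smooth⇒des a w smooth (All.tail (↭range⇒positive {n} σ↭))) ⟩
  ⌊ length w /2⌋
    ≡⟨ ≡.cong (λ m → ⌊ m ∸ 1 /2⌋) (≡.trans (↭-length σ↭) (length-range n)) ⟩
  ⌊ n ∸ 1 /2⌋                          ∎
  where
  open ℕₚ.≤-Reasoning
  σ↭ : a ∷ w ↭ range n
  σ↭ = proj₁ (∈-andre⁻ {n} σ∈)
  smooth : Smooth (a ∷ w)
  smooth = ≡.subst Smooth (subword-all (All.tabulate (λ b∈ → proj₂ (∈-range⁻ (∈-resp-↭ σ↭ b∈)))))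
    (proj₂ (∈-andre⁻ {n} σ∈) n ℕₚ.≤-refl)

hooks-slotless : ∀ S → slots S ≡ 0 → hooks S ≡ 0
hooks-slotless []             _  = ≡.refl
hooks-slotless (letter a ∷ S) eq = hooks-slotless S eq

les-des-balance : ∀ i L h′ l h s d e → i ℕ.+ h′ ≡ l ℕ.+ h ℕ.+ s → L ℕ.+ h ≡ d ℕ.+ e →
  i ℕ.+ L ℕ.+ h′ ≡ s ℕ.+ d ℕ.+ (l ℕ.+ e)
les-des-balance i L h′ l h s d e eq eq′ = begin
  i ℕ.+ L ℕ.+ h′             ≡⟨ solve 3 (λ i L h → i :+ L :+ h := i :+ h :+ L) ≡.refl i L h′ ⟩
  i ℕ.+ h′ ℕ.+ L             ≡⟨ ≡.cong (ℕ._+ L) eq ⟩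
  l ℕ.+ h ℕ.+ s ℕ.+ L
    ≡⟨ solve 4 (λ l h s L → l :+ h :+ s :+ L := s :+ l :+ (L :+ h)) ≡.refl l h s L ⟩
  s ℕ.+ l ℕ.+ (L ℕ.+ h)      ≡⟨ ≡.cong (s ℕ.+ l ℕ.+_) eq′ ⟩
  s ℕ.+ l ℕ.+ (d ℕ.+ e)
    ≡⟨ solve 4 (λ s l d e → s :+ l :+ (d :+ e) := s :+ d :+ (l :+ e)) ≡.refl s l d e ⟩
  s ℕ.+ d ℕ.+ (l ℕ.+ e)      ∎
  where
  open ≡.≡-Reasoning
  open +-*-Solver using (solve; _:+_; _:=_)

-- Rearranging sums and grouping by number of descents.

module Regrouping {c ℓ : Level} (R : CommutativeSemiring c ℓ) where
  open CommutativeSemiring R renaming (Carrier to C)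
  open import Algebra.Solver.Ring.NaturalCoefficients.Default R using (solve; _:=_; _:+_; _:*_)
  open import Relation.Binary.Reasoning.Setoid setoid
  open Sums R

  sumList-↭ : ∀ {A : Set} (f : A → C) {xs ys} → xs ↭ ys → sumList R f xs ≈ sumList R f ys
  sumList-↭ f ↭.refl      = refl
  sumList-↭ f (↭.prep x p) = +-congˡ (sumList-↭ f p)
  sumList-↭ f (↭.swap {xs} {ys} x y p) = begin
    f x + (f y + sumList R f xs)   ≈⟨ +-congˡ (+-congˡ (sumList-↭ f p)) ⟩
    f x + (f y + sumList R f ys)   ≈⟨ solve 3 (λ a b c → a :+ (b :+ c) := b :+ (a :+ c)) refl _ _ _ ⟩
    f y + (f x + sumList R f ys)   ∎
  sumList-↭ f (↭.trans p q) = trans (sumList-↭ f p) (sumList-↭ f q)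

  at : ℕ → ℕ → C → C
  at j k a = if j ≡ᵇ k then a else 0#

  at-≢ : ∀ {j k} a → j ≢ k → at j k a ≈ 0#
  at-≢ {j} {k} a j≢k with j ≡ᵇ k in eq
  ... | false = refl
  ... | true  = contradiction (ℕₚ.≡ᵇ⇒≡ j k (≡.subst T (≡.sym eq) _)) j≢k

  at-≡ : ∀ j a → at j j a ≈ a
  at-≡ j a with j ≡ᵇ j in eq
  ... | true  = refl
  ... | false with () ← ≡.subst T eq (ℕₚ.≡⇒≡ᵇ j j ≡.refl)

  sumTo-at : ∀ n {j} (a : ℕ → C) → j < n → sumTo R n (λ k → at j k (a k)) ≈ a j
  sumTo-at (suc n) {j} a j≤n with ℕₚ.m≤n⇒m<n∨m≡n (s≤s⁻¹ j≤n)
  ... | inj₁ j<n    = trans (+-cong (sumTo-at n a j<n) (at-≢ (a n) (ℕₚ.<⇒≢ j<n))) (+-identityʳ _)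
  ... | inj₂ ≡.refl = trans (+-cong
          (sumTo-zero n (λ k k<n → at-≢ (a k) (ℕₚ.>⇒≢ k<n))) (at-≡ n (a n))) (+-identityˡ _)

  module _ {A : Set} (d : A → ℕ) (f : ℕ → A → C) (w : ℕ → C) where

    class : ℕ → List A → List A
    class k = filter (λ x → (d x ≡ᵇ k) ≟ᵇ true)

    class-∷ : ∀ k x xs →
      sumList R (f k) (class k (x ∷ xs)) * w k
        ≈ at (d x) k (f k x * w k) + sumList R (f k) (class k xs) * w k
    class-∷ k x xs with d x ≡ᵇ k
    ... | true  = distribʳ _ _ _
    ... | false = sym (+-identityˡ _)

    -- Each x meets only the class k = d x. The summand may itself depend on k, as `dnk` subtracts k
    -- where `andreSum` subtracts `des`.
    sumTo-classes : ∀ n xs → (∀ {x} → x ∈ xs → d x < n) →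
      sumTo R n (λ k → sumList R (f k) (class k xs) * w k) ≈ sumList R (λ x → f (d x) x * w (d x)) xs
    sumTo-classes n []       _  = sumTo-zero n (λ _ _ → zeroˡ _)
    sumTo-classes n (x ∷ xs) d< = begin
      sumTo R n (λ k → sumList R (f k) (class k (x ∷ xs)) * w k)
        ≈⟨ sumTo-cong n (λ k _ → class-∷ k x xs) ⟩
      sumTo R n (λ k → at (d x) k (f k x * w k) + sumList R (f k) (class k xs) * w k)
        ≈⟨ sumTo-+ n _ _ ⟩
      sumTo R n (λ k → at (d x) k (f k x * w k)) + sumTo R n (λ k → sumList R (f k) (class k xs) * w k)
        ≈⟨ +-cong (sumTo-at n _ (d< (here ≡.refl))) (sumTo-classes n xs (d< ∘ there)) ⟩
      f (d x) x * w (d x) + sumList R (λ x → f (d x) x * w (d x)) xs ∎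

-- Summation over insertion histories.

module Enumeration {c ℓ : Level} (R : CommutativeSemiring c ℓ)
                   (p q t : CommutativeSemiring.Carrier R) where
  open CommutativeSemiring R renaming (Carrier to C)
  open import Algebra.Solver.Ring.NaturalCoefficients.Default R using (solve; _:=_; _:+_; _:*_)
  open import Relation.Binary.Reasoning.Setoid setoid
  open Sums R
  open Gaussian R p q
  open ContinuedFraction R p q t
  open Regrouping R

  monomial : ℕ → ℕ → ℕ → C
  monomial r e d = pw R p r * pw R q e * pw R t d

  weight : List ℕ → C
  weight σ = monomial (res σ) (les σ ∸ des σ) (des σ)

  pw-splits : ∀ k κ {m m′} → suc m′ ≡ grow κ m →
              pw R t (splits κ) * completions k m′ ≈ continue k m κ
  pw-splits k fill   ≡.refl = *-identityˡ _
  pw-splits k extend ≡.refl = *-identityˡ _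
  pw-splits k split  ≡.refl = *-congʳ (*-identityʳ t)

  potential-slotless : ∀ S → slots S ≡ 0 → potential S ≈ 1#
  potential-slotless []             _  = refl
  potential-slotless (letter a ∷ S) eq = potential-slotless S eq

  -- A hook stands for a descent not yet matched in les; e is the exponent of q
  -- accumulated so far.
  fillings-sum : ∀ {N} k {x S e} → 0 < x → k ℕ.+ x ≤ N → Valid x S →
    les (word N S) ℕ.+ hooks S ≡ des (word N S) ℕ.+ e →
    sumList R weight (fillings k x S) ≈
      monomial (res (word N S)) e (des (word N S)) * (completions k (slots S) * potential S)
  fillings-sum {N} zero {S = S} {e} _ _ _ bal with slots S in eq
  ... | suc _ = sym (trans (*-congˡ (zeroˡ _)) (zeroʳ _))
  -- Without slots there are no hooks, so `bal` reads les = des + e and the truncated difference is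
  -- exactly e.
  ... | zero
    rewrite word-slotless N S eq | hooks-slotless S eq | ℕₚ.+-identityʳ (les (letters S)) | bal
          | ℕₚ.m+n∸m≡n (des (letters S)) e = begin
    monomial (res (letters S)) e (des (letters S)) + 0#   ≈⟨ +-identityʳ _ ⟩
    monomial (res (letters S)) e (des (letters S))        ≈⟨ sym (*-identityʳ _) ⟩
    monomial (res (letters S)) e (des (letters S)) * 1#
      ≈⟨ *-congˡ (sym (trans (*-identityˡ _) (potential-slotless S eq))) ⟩
    monomial (res (letters S)) e (des (letters S)) * (1# * potential S) ∎
  fillings-sum {N} (suc k) {x} {S} {e} 0<x k+x≤N v bal = begin
    sumList R weight (fillings (suc k) x S)
      ≈⟨ sumList-concatMap weight (fillings k (suc x) ∘ result) (moves x S) ⟩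
    sumList R (sumList R weight ∘ fillings k (suc x) ∘ result) (moves x S)
      ≈⟨ sumList-cong (moves x S) (λ {o} o∈ → step (∈-moves⁻ S o∈)) ⟩
    sumList R (λ o → M * term φ o) (moves x S)
      ≈⟨ sumList-*ˡ M (term φ) (moves x S) ⟩
    M * sumList R (term φ) (moves x S)
      ≈⟨ *-congˡ (moves-sum x S φ) ⟩
    M * (completions (suc k) (slots S) * potential S) ∎
    where
    open Statistics {x} {N} (ℕₚ.≤-trans (s≤s (ℕₚ.m≤n+m x k)) k+x≤N)
    W = word N S
    M = monomial (res W) e (des W)
    φ = continue k (slots S)
    step : ∀ {κ r l S′} → Move x κ r l S S′ →
      sumList R weight (fillings k (suc x) S′) ≈ M * term φ (κ , r , l , S′)
    step {κ} {r} {l} {S′} m with i , ρ , hooks-eq ← Move-refine v m = begin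
      sumList R weight (fillings k (suc x) S′)
        ≈⟨ fillings-sum k (s≤s z≤n) (ℕₚ.≤-trans (ℕₚ.≤-reflexive (ℕₚ.+-suc k x)) k+x≤N)
             (Move-valid 0<x m v) balance ⟩
      monomial (res W′) (l ℕ.+ e) (des W′) * (completions k (slots S′) * potential S′)
        ≈⟨ *-congʳ (*-cong (*-cong
             (trans (reflexive (≡.cong (pw R p) (res-refine ρ))) (pw-+ p r (res W))) (pw-+ q l e))
             (trans (reflexive (≡.cong (pw R t) (des-refine ρ))) (pw-+ t (splits κ) (des W)))) ⟩
      pw R p r * pw R p (res W) * (pw R q l * pw R q e) * (pw R t (splits κ) * pw R t (des W))
        * (completions k (slots S′) * potential S′)
        ≈⟨ solve 8 (λ pr p₀ ql q₀ ts t₀ c g →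
             pr :* p₀ :* (ql :* q₀) :* (ts :* t₀) :* (c :* g)
             := p₀ :* q₀ :* t₀ :* (pr :* (ql :* (ts :* c :* g)))) refl _ _ _ _ _ _ _ _ ⟩
      M * (pw R p r * (pw R q l * (pw R t (splits κ) * completions k (slots S′) * potential S′)))
        ≈⟨ *-congˡ (*-congˡ (*-congˡ (*-congʳ (pw-splits k κ (Move-slots m))))) ⟩
      M * term φ (κ , r , l , S′) ∎
      where
      W′ = word N S′
      balance : les W′ ℕ.+ hooks S′ ≡ des W′ ℕ.+ (l ℕ.+ e)
      balance rewrite les-refine ρ | des-refine ρ =
        les-des-balance i (les W) (hooks S′) l (hooks S) (splits κ) (des W) e hooks-eq bal

  andreSum≈completions : ∀ n → andreSum R p q t (suc n) ≈ completions (suc n) 1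
  andreSum≈completions n = begin
    sumList R weight (andre (suc n))            ≈⟨ sumList-↭ weight (andre↭fillings n) ⟩
    sumList R weight (fillings (suc n) 1 unfilled)
      -- N = n + 2 is the least value above all inserted letters. The one-letter word N has no
      -- statistics, so e = 0, and the initial potential is [1] = 1.
      ≈⟨ fillings-sum {suc n ℕ.+ 1} (suc n) (s≤s z≤n) ℕₚ.≤-refl unfilled-valid ≡.refl ⟩
    1# * 1# * 1# * (completions (suc n) 1 * ((0# + 1# * 1#) * 1#))
      ≈⟨ *-cong (trans (*-identityʳ _) (*-identityʳ _))
           (*-congˡ (trans (*-identityʳ _) (trans (+-identityˡ _) (*-identityˡ _)))) ⟩
    1# * (completions (suc n) 1 * 1#)           ≈⟨ trans (*-identityˡ _) (*-identityʳ _) ⟩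
    completions (suc n) 1                       ∎

  middleSum≈andreSum : ∀ n → middleSum R p q t n ≈ andreSum R p q t n
  middleSum≈andreSum n = sumTo-classes des (λ k σ → pw R p (res σ) * pw R q (les σ ∸ k)) (pw R t)
    (suc ⌊ n ∸ 1 /2⌋) (andre n) (s≤s ∘ andre-des n)

theorem1p7 : ∀ {c ℓ : Level} (R : CommutativeSemiring c ℓ) (n : ℕ) → 1 ≤ n →
    (p q t : CommutativeSemiring.Carrier R) →
    CommutativeSemiring._≈_ R (D R p q t n) (middleSum R p q t n) ×
    CommutativeSemiring._≈_ R (middleSum R p q t n) (andreSum R p q t n)
theorem1p7 R (suc n) _ p q t =
  ≈-trans (D≈completions n)
    (≈-trans (≈-sym (andreSum≈completions n)) (≈-sym (middleSum≈andreSum (suc n)))) ,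
  middleSum≈andreSum (suc n)
  where
  open CommutativeSemiring R using () renaming (sym to ≈-sym; trans to ≈-trans)
  open ContinuedFraction R p q t using (D≈completions)
  open Enumeration R p q t
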